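{- Let $p\in S_n$ be a pattern avoiding $1324$. If for at least one choice of $q$ among $p,\ p^{ -1},\ p^{\mathrm{rc}},\ (p^{\mathrm{rc}})^{ -1}$ one of the following conditions holds, then $p$ is $f$-incompatible: (a) $\mathrm{comp}(q)\ge 3$. (b) $q_1<n$ and $\mathrm{comp}(q\smallsetminus q_1)>\mathrm{comp}(q)$. (c) $q_1>1$, $\mathrm{comp}(q)=2$, and the first component of $q$ begins with its largest entry. (d) $1<q_1<n$ and $q\smallsetminus q_1$ avoids $213$. In cases (b), (c) and (d), if $q$ is chosen as $p^{\mathrm{rc}}$ or $(p^{\mathrm{rc}})^{ -1}$, it is required further that $q_1<n-1$.
   Context: Notation. $\mathrm{Av}(B)$ is the set of permutations avoiding all patterns in $B$ (no subsequence order-isomorphic to a pattern in $B$). For $\pi\in S_n$ and a value $e\in[n]$, $\pi\smallsetminus e$ is the permutation order-isomorphic to the sequence obtained by deleting the entry with value $e$ from $\pi$. The direct sum $\sigma\oplus\tau$ of $\sigma\in S_a,\tau\in S_b$ is $\sigma$ followed by $\tau$ with all values shifted up by $a$. A permutation is decomposable if it is a direct sum of two nonempty permutations, and indecomposable otherwise. Every permutation is uniquely a direct sum of nonempty indecomposable permutations, called its components; $\mathrm{comp}(\pi)$ is their number. $\mathrm{id}_m$ is the identity permutation of length $m$ ($\mathrm{id}_0$ is empty). The reverse-complement of $\pi\in S_n$ is $\pi^{\mathrm{rc}}$ with $\pi^{\mathrm{rc}}_i=n+1-\pi_{n+1-i}$. A permutation $\pi\in S_n$ is almost decomposable if it is indecomposable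 but $\pi\smallsetminus e$ is decomposable for some $e\in\{1,\pi_1,n,\pi_n\}$. The map $f$. Every decomposable $1324$-avoider can be written uniquely as $\pi=\sigma\oplus\mathrm{id}_m\oplus\tau$ with $m\ge0$, $\sigma$ an indecomposable $132$-avoider and $\tau$ an indecomposable $213$-avoider (both nonempty); set $\widetilde f(\pi)=\sigma\oplus\mathrm{id}_{m+1}\oplus\tau$. For a decomposable $1324$-avoider set $f(\pi)=\widetilde f(\pi)$. For an almost decomposable $1324$-avoider $\pi$ define $f(\pi)$ (of length $|\pi|+1$) as follows: (1) if $\pi\smallsetminus\pi_1$ is decomposable, $f(\pi)$ is the permutation with $f(\pi)_1=\pi_1$ and $f(\pi)\smallsetminus\pi_1=\widetilde f(\pi\smallsetminus\pi_1)$; (2) if $\pi\smallsetminus 1$ is decomposable, $f(\pi)=f(\pi^{ -1})^{ -1}$; (3) otherwise (both $\pi\smallsetminus\pi_1$ and $\pi\smallsetminus1$ indecomposable), $f(\pi)=f(\pi^{\mathrm{rc}})^{\mathrm{rc}}$. (For almost decomposable $1324$-avoiders, cases (1) and (2) cannot occur simultaneously.) A pattern $p$ is $f$-compatible if $f(\pi)$ avoids $p$ for every decomposable or almost decomposable permutation $\pi\in\mathrm{Av}(1324,p)$; otherwise it is $f$-incompatible. -}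

module Defs where

open import Data.Nat.Base using (ℕ; zero; suc; _+_; _∸_; _≤_; _<_; _≥_; _>_; z≤n; s≤s)
open import Data.Nat.Induction using (Acc; acc; <-wellFounded)
import Data.Nat.Properties as ℕ
open import Data.Fin.Base as Fin
  using (Fin; zero; suc; toℕ; fromℕ; inject₁; fromℕ<; splitAt; _↑ˡ_; _↑ʳ_)
open import Data.Fin.Patterns using (0F; 1F; 2F)
import Data.Fin.Properties as Fin
open import Data.Fin.Permutation
  using (Permutation′; permutation; _⟨$⟩ʳ_; _⟨$⟩ˡ_; id; flip; reverse; remove; transpose; _∘ₚ_;
         inverseˡ; inverseʳ)
open import Data.List.Base using (List; []; _∷_; length; head)
open import Data.List.Relation.Unary.All using (All; []; _∷_)
open import Data.Maybe.Relation.Unary.Any using (Any)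
open import Data.Product.Base using (Σ-syntax; ∃-syntax; _×_; _,_; proj₁; proj₂)
open import Data.Sum.Base using (_⊎_; inj₁; inj₂)
open import Data.Sum.Function.Propositional using (_⊎-↔_)
open import Data.Unit.Base using (⊤)
open import Function.Base using (_∘_)
open import Function.Bundles using (_⇔_)
open import Function.Construct.Composition using (_↔-∘_)
open import Function.Construct.Symmetry using (↔-sym)
open import Relation.Binary.PropositionalEquality
  using (_≡_; refl; sym; trans; cong; subst)
open import Relation.Nullary using (¬_; Dec)
open import Relation.Nullary.Decidable using (_×-dec_; _→-dec_; ¬?; decidable-stable)

private
  variable
    k m n : ℕ

-- A permutation π ∈ Sₙ is a bijection π : Permutation′ n of Fin n with itself;
-- positions and values are shifted down by one, so that `zero` stands for 1 and
-- `fromℕ n : Fin (suc n)` for the largest value or last position.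

infix 4 _≋_

-- Equality of one-line notations.  The lengths need not agree definitionally,
-- which matters for direct sums.
_≋_ : Permutation′ m → Permutation′ n → Set
_≋_ {m} {n} π ρ = m ≡ n × (∀ i j → toℕ i ≡ toℕ j → toℕ (π ⟨$⟩ʳ i) ≡ toℕ (ρ ⟨$⟩ʳ j))

first : Permutation′ (suc n) → Fin (suc n)
first π = π ⟨$⟩ʳ zero

last : Permutation′ (suc n) → Fin (suc n)
last {n} π = π ⟨$⟩ʳ fromℕ n

-- The first entry in the usual numbering 1, …, n of the values.
first₁ : Permutation′ (suc n) → ℕ
first₁ π = suc (toℕ (first π))

infixl 7 _∖_

-- e is a value; the library's `remove` takes the position of the deleted entry.
_∖_ : Permutation′ (suc n) → Fin (suc n) → Permutation′ n
π ∖ e = remove (π ⟨$⟩ˡ e) π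

_ʳᶜ : Permutation′ n → Permutation′ n
π ʳᶜ = reverse ∘ₚ π ∘ₚ reverse

infixr 6 _⊕_

_⊕_ : Permutation′ m → Permutation′ n → Permutation′ (m + n)
σ ⊕ τ = ↔-sym Fin.+↔⊎ ↔-∘ ((σ ⊎-↔ τ) ↔-∘ Fin.+↔⊎)

Contains : Permutation′ n → Permutation′ k → Set
Contains {n} {k} π p =
  Σ[ e ∈ (Fin k → Fin n) ]
    (∀ i j → i Fin.< j → e i Fin.< e j) ×
    (∀ i j → (π ⟨$⟩ʳ e i Fin.< π ⟨$⟩ʳ e j) ⇔ (p ⟨$⟩ʳ i Fin.< p ⟨$⟩ʳ j))

Avoids : Permutation′ n → Permutation′ k → Set
Avoids π p = ¬ Contains π p

p1324 : Permutation′ 4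
p1324 = transpose 1F 2F

p132 p213 : Permutation′ 3
p132 = transpose 1F 2F
p213 = transpose 0F 1F

Decomposable : Permutation′ n → Set
Decomposable π =
  ∃[ a ] ∃[ b ] Σ[ σ ∈ Permutation′ (suc a) ] Σ[ τ ∈ Permutation′ (suc b) ] π ≋ σ ⊕ τ

Indecomposable : Permutation′ n → Set
Indecomposable π = ¬ Decomposable π

-- The empty permutation has no entry to delete, so only positive lengths occur.
AlmostDecomposable : Permutation′ (suc n) → Set
AlmostDecomposable {n} π =
  Indecomposable π ×
  Σ[ e ∈ Fin (suc n) ]
    (e ≡ zero ⊎ e ≡ first π ⊎ e ≡ fromℕ n ⊎ e ≡ last π) × Decomposable (π ∖ e)

Component : Set
Component = Σ[ n ∈ ℕ ] Permutation′ (suc n)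

totalLength : List Component → ℕ
totalLength []             = 0
totalLength ((n , _) ∷ cs) = suc n + totalLength cs

⨁ : (cs : List Component) → Permutation′ (totalLength cs)
⨁ []             = id
⨁ ((_ , σ) ∷ cs) = σ ⊕ ⨁ cs

record Decomposition (π : Permutation′ n) : Set where
  field
    parts          : List Component
    indecomposable : All (λ c → Indecomposable (proj₂ c)) parts
    sum            : π ≋ ⨁ parts

-- Every permutation has a decomposition into indecomposables: repeatedly split off
-- the shortest prefix whose positions carry the smallest values.
module Existence where
  ⊕-↑ˡ : (σ : Permutation′ m) (τ : Permutation′ n) (i : Fin m) →
         (σ ⊕ τ) ⟨$⟩ʳ (i ↑ˡ n) ≡ (σ ⟨$⟩ʳ i) ↑ˡ n
  ⊕-↑ˡ {m} {n} σ τ i rewrite Fin.splitAt-↑ˡ m i n = refl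

  ⊕-↑ʳ : (σ : Permutation′ m) (τ : Permutation′ n) (j : Fin n) →
         (σ ⊕ τ) ⟨$⟩ʳ (m ↑ʳ j) ≡ m ↑ʳ (τ ⟨$⟩ʳ j)
  ⊕-↑ʳ {m} {n} σ τ j rewrite Fin.splitAt-↑ʳ m n j = refl

  data SumView (m : ℕ) {n} : Fin (m + n) → Set where
    left  : (i : Fin m) → SumView m (i ↑ˡ n)
    right : (j : Fin n) → SumView m (m ↑ʳ j)

  sumView : ∀ m {n} (i : Fin (m + n)) → SumView m i
  sumView m {n} i with splitAt m i in eq
  ... | inj₁ j = subst (SumView m) (Fin.splitAt⁻¹-↑ˡ eq) (left j)
  ... | inj₂ j = subst (SumView m) (Fin.splitAt⁻¹-↑ʳ eq) (right j)

  ≈⇒≋ : {π ρ : Permutation′ n} → (∀ i → π ⟨$⟩ʳ i ≡ ρ ⟨$⟩ʳ i) → π ≋ ρ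
  ≈⇒≋ {π = π} {ρ} h = refl , λ i j eq →
    cong toℕ (trans (h i) (cong (ρ ⟨$⟩ʳ_) (Fin.toℕ-injective eq)))

  ≋⇒≈ : {π ρ : Permutation′ n} → π ≋ ρ → ∀ i → π ⟨$⟩ʳ i ≡ ρ ⟨$⟩ʳ i
  ≋⇒≈ h i = Fin.toℕ-injective (proj₂ h i i refl)

  -- The first k positions carry the k smallest values.
  Closed : ℕ → Permutation′ n → Set
  Closed k π = ∀ i → (toℕ i < k → toℕ (π ⟨$⟩ʳ i) < k) × (toℕ (π ⟨$⟩ʳ i) < k → toℕ i < k)

  closed? : ∀ k (π : Permutation′ n) → Dec (Closed k π)
  closed? k π = Fin.all? λ i →
    (toℕ i ℕ.<? k →-dec toℕ (π ⟨$⟩ʳ i) ℕ.<? k) ×-dec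
    (toℕ (π ⟨$⟩ʳ i) ℕ.<? k →-dec toℕ i ℕ.<? k)

  closed-flip : ∀ k (π : Permutation′ n) → Closed k π → Closed k (flip π)
  closed-flip k π c j =
    (λ lt → proj₂ (c (π ⟨$⟩ˡ j)) (subst (λ x → toℕ x < k) (sym (inverseʳ π)) lt)) ,
    (λ lt → subst (λ x → toℕ x < k) (inverseʳ π) (proj₁ (c (π ⟨$⟩ˡ j)) lt))

  closed-≈ : ∀ k {π ρ : Permutation′ n} → (∀ i → π ⟨$⟩ʳ i ≡ ρ ⟨$⟩ʳ i) → Closed k ρ → Closed k π
  closed-≈ k h c i rewrite h i = c i

  closed-⊕ : ∀ {k} (σ : Permutation′ m) (τ : Permutation′ n) →
             k ≤ m → Closed k σ → Closed k (σ ⊕ τ)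
  closed-⊕ {m} {n} {k} σ τ k≤m c x with sumView m x
  ... | left i rewrite ⊕-↑ˡ σ τ i | Fin.toℕ-↑ˡ i n | Fin.toℕ-↑ˡ (σ ⟨$⟩ʳ i) n = c i
  ... | right j rewrite ⊕-↑ʳ σ τ j | Fin.toℕ-↑ʳ m j | Fin.toℕ-↑ʳ m (τ ⟨$⟩ʳ j) =
    (λ lt → absurd lt) , (λ lt → absurd lt)
    where
    absurd : ∀ {y z} → m + y < k → m + z < k
    absurd {y} lt with () ← ℕ.<⇒≱ lt (ℕ.≤-trans k≤m (ℕ.m≤m+n m y))

  closed-top : (σ : Permutation′ m) → Closed m σ
  closed-top σ i = (λ _ → Fin.toℕ<n _) , (λ _ → Fin.toℕ<n _)

  decomposable⇒closed : (π : Permutation′ (suc n)) → Decomposable π →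
                        ∃[ a ] a < n × Closed (suc a) π
  decomposable⇒closed {n} π (a , b , σ , τ , refl , h) =
    a , ℕ.m<m+n a (s≤s z≤n) ,
    closed-≈ (suc a) {π} {σ ⊕ τ} (≋⇒≈ {π = π} {σ ⊕ τ} (refl , h))
      (closed-⊕ σ τ ℕ.≤-refl (closed-top σ))

  module Split (k : ℕ) {r : ℕ} where
    low : (π : Permutation′ (k + r)) → Closed k π → ∀ i → ∃[ i′ ] i′ ↑ˡ r ≡ π ⟨$⟩ʳ (i ↑ˡ r)
    low π c i with π ⟨$⟩ʳ (i ↑ˡ r) | c (i ↑ˡ r)
    ... | x | (c→ , _) with sumView k x
    ...   | left i′ = i′ , refl
    ...   | right j with () ← ℕ.<⇒≱ (subst (_< k) (Fin.toℕ-↑ʳ k j)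
                                (c→ (subst (_< k) (sym (Fin.toℕ-↑ˡ i r)) (Fin.toℕ<n i))))
                                (ℕ.m≤m+n k (toℕ j))

    high : (π : Permutation′ (k + r)) → Closed k π → ∀ j → ∃[ j′ ] k ↑ʳ j′ ≡ π ⟨$⟩ʳ (k ↑ʳ j)
    high π c j with π ⟨$⟩ʳ (k ↑ʳ j) | c (k ↑ʳ j)
    ... | x | (_ , c←) with sumView k x
    ...   | right j′ = j′ , refl
    ...   | left i with () ← ℕ.<⇒≱ (subst (_< k) (Fin.toℕ-↑ʳ k j)
                                (c← (subst (_< k) (sym (Fin.toℕ-↑ˡ i r)) (Fin.toℕ<n i))))
                                (ℕ.m≤m+n k (toℕ j))

    split : (π : Permutation′ (k + r)) → Closed k π →
            Σ[ σ ∈ Permutation′ k ] Σ[ τ ∈ Permutation′ r ] (∀ i → π ⟨$⟩ʳ i ≡ (σ ⊕ τ) ⟨$⟩ʳ i)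
    split π c = σ , τ , agree
      where
      c′ = closed-flip k π c
      l→ = low π c
      l← = low (flip π) c′
      h→ = high π c
      h← = high (flip π) c′

      σ : Permutation′ k
      σ = permutation (proj₁ ∘ l→) (proj₁ ∘ l←)
        (λ i → Fin.↑ˡ-injective r _ _ (trans (proj₂ (l→ (proj₁ (l← i))))
                 (trans (cong (π ⟨$⟩ʳ_) (proj₂ (l← i))) (inverseʳ π))))
        (λ i → Fin.↑ˡ-injective r _ _ (trans (proj₂ (l← (proj₁ (l→ i))))
                 (trans (cong (π ⟨$⟩ˡ_) (proj₂ (l→ i))) (inverseˡ π))))

      τ : Permutation′ r
      τ = permutation (proj₁ ∘ h→) (proj₁ ∘ h←)
        (λ i → Fin.↑ʳ-injective k _ _ (trans (proj₂ (h→ (proj₁ (h← i))))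
                 (trans (cong (π ⟨$⟩ʳ_) (proj₂ (h← i))) (inverseʳ π))))
        (λ i → Fin.↑ʳ-injective k _ _ (trans (proj₂ (h← (proj₁ (h→ i))))
                 (trans (cong (π ⟨$⟩ˡ_) (proj₂ (h→ i))) (inverseˡ π))))

      agree : ∀ i → π ⟨$⟩ʳ i ≡ (σ ⊕ τ) ⟨$⟩ʳ i
      agree i with sumView k i
      ... | left j  = trans (sym (proj₂ (l→ j))) (sym (⊕-↑ˡ σ τ j))
      ... | right j = trans (sym (proj₂ (h→ j))) (sym (⊕-↑ʳ σ τ j))

  ⊕-congʳ : ∀ {n′} (σ : Permutation′ m) {τ : Permutation′ n} {τ′ : Permutation′ n′} →
            τ ≋ τ′ → σ ⊕ τ ≋ σ ⊕ τ′
  ⊕-congʳ {m} {n} σ {τ} {τ′} (refl , h) = ≈⇒≋ {π = σ ⊕ τ} {σ ⊕ τ′} go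
    where
    go : ∀ i → (σ ⊕ τ) ⟨$⟩ʳ i ≡ (σ ⊕ τ′) ⟨$⟩ʳ i
    go i with sumView m i
    ... | left j  = trans (⊕-↑ˡ σ τ j) (sym (⊕-↑ˡ σ τ′ j))
    ... | right j = trans (⊕-↑ʳ σ τ j)
      (trans (cong (m ↑ʳ_) (≋⇒≈ {π = τ} {τ′} (refl , h) j)) (sym (⊕-↑ʳ σ τ′ j)))

  ≋-transˡ : ∀ {n′} {π ρ : Permutation′ n} {ρ′ : Permutation′ n′} →
             (∀ i → π ⟨$⟩ʳ i ≡ ρ ⟨$⟩ʳ i) → ρ ≋ ρ′ → π ≋ ρ′
  ≋-transˡ h (eq , g) = eq , λ i j e → trans (cong toℕ (h i)) (g i j e)

  shortestPrefix : (π : Permutation′ (suc n)) →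
    ∃[ a ] a ≤ n × Closed (suc a) π × (∀ {b} → b < a → ¬ Closed (suc b) π)
  shortestPrefix {n} π =
    let P? i = ¬? (closed? (suc (toℕ i)) π)
        i , ¬¬c , below = Fin.¬∀⟶∃¬-smallest (suc n) (λ i → ¬ Closed (suc (toℕ i)) π) P?
          (λ all → all (fromℕ n)
             (subst (λ x → Closed (suc x) π) (sym (Fin.toℕ-fromℕ n)) (closed-top π)))
    in toℕ i , ℕ.≤-pred (Fin.toℕ<n i) , decidable-stable (closed? _ π) ¬¬c ,
       λ {b} b<i → subst (λ x → ¬ Closed (suc x) π)
         (trans (Fin.toℕ-inject (fromℕ< b<i)) (Fin.toℕ-fromℕ< b<i))
         (below (fromℕ< b<i))

  peel : ∀ a {r} (π : Permutation′ (suc a + r)) → Closed (suc a) π →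
         (∀ {b} → b < a → ¬ Closed (suc b) π) →
         (∀ (τ : Permutation′ r) → Decomposition τ) → Decomposition π
  peel a π c minimal rec with Split.split (suc a) π c
  ... | σ , τ , agree = record
    { parts          = (a , σ) ∷ D.parts
    ; indecomposable = indec ∷ D.indecomposable
    ; sum            = ≋-transˡ {π = π} {σ ⊕ τ} {σ ⊕ ⨁ D.parts} agree
                         (⊕-congʳ σ {τ} {⨁ D.parts} D.sum)
    }
    where
    module D = Decomposition (rec τ)
    indec : Indecomposable σ
    indec d with decomposable⇒closed σ d
    ... | b , b<a , cb = minimal b<a (closed-≈ (suc b) {π} {σ ⊕ τ} agree
            (closed-⊕ σ τ (ℕ.<⇒≤ (s≤s b<a)) cb))

  decompose′ : ∀ n → Acc _<_ n → (π : Permutation′ n) → Decomposition π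
  decompose′ zero _ π = record { parts = [] ; indecomposable = [] ; sum = refl , λ () }
  decompose′ (suc n) (acc rs) π with shortestPrefix π
  ... | a , a≤n , c , minimal = helper (n ∸ a) (ℕ.m+[n∸m]≡n a≤n) rs π c minimal
    where
    helper : ∀ r {n} → a + r ≡ n → (∀ {m} → m < suc n → Acc _<_ m) →
             (π : Permutation′ (suc n)) → Closed (suc a) π →
             (∀ {b} → b < a → ¬ Closed (suc b) π) → Decomposition π
    helper r refl rs π c minimal =
      peel a π c minimal (decompose′ r (rs (s≤s (ℕ.m≤n+m r a))))

decompose : (π : Permutation′ n) → Decomposition π
decompose {n} = Existence.decompose′ n (<-wellFounded n)

components : Permutation′ n → List Component
components π = Decomposition.parts (decompose π)

comp : Permutation′ n → ℕ
comp π = length (components π)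

BeginsWithLargest : Component → Set
BeginsWithLargest (n , σ) = first σ ≡ fromℕ n

infix 4 _↦̃_ _↦_

-- The graphs of f̃ and f: `π ↦̃ ρ` means f̃(π) = ρ, and `π ↦ ρ` means f(π) = ρ.
-- As inversion and reverse-complement are involutions, f(π) = f(π⁻¹)⁻¹ says that
-- π⁻¹ ↦ ρ⁻¹ for ρ = f(π), and similarly for the reverse-complement.
data _↦̃_ {n} (π : Permutation′ n) (ρ : Permutation′ (suc n)) : Set where
  f̃-sum : ∀ {a b} m (σ : Permutation′ (suc a)) (τ : Permutation′ (suc b)) →
          Indecomposable σ → Avoids σ p132 →
          Indecomposable τ → Avoids τ p213 →
          π ≋ σ ⊕ id {m} ⊕ τ →
          ρ ≋ σ ⊕ id {suc m} ⊕ τ →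
          π ↦̃ ρ

data _↦_ {n} (π : Permutation′ (suc n)) (ρ : Permutation′ (suc (suc n))) : Set where
  f-decomposable :
    Avoids π p1324 → Decomposable π →
    π ↦̃ ρ → π ↦ ρ
  f-case₁ :
    Avoids π p1324 → AlmostDecomposable π →
    Decomposable (π ∖ first π) →
    first ρ ≡ inject₁ (first π) → (π ∖ first π) ↦̃ (ρ ∖ first ρ) →
    π ↦ ρ
  f-case₂ :
    Avoids π p1324 → AlmostDecomposable π →
    Decomposable (π ∖ zero) →
    flip π ↦ flip ρ →
    π ↦ ρ
  f-case₃ :
    Avoids π p1324 → AlmostDecomposable π →
    Indecomposable (π ∖ first π) → Indecomposable (π ∖ zero) →
    (π ʳᶜ) ↦ (ρ ʳᶜ) →
    π ↦ ρ

-- f is total and single-valued on this domain, so quantifying over all ρ with π ↦ ρ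
-- speaks of the one value f(π).
Compatible : Permutation′ k → Set
Compatible p =
  ∀ {n} (π : Permutation′ (suc n)) →
  Decomposable π ⊎ AlmostDecomposable π →
  Avoids π p1324 → Avoids π p →
  ∀ ρ → π ↦ ρ → Avoids ρ p

Incompatible : Permutation′ k → Set
Incompatible p = ¬ Compatible p

data Symmetry : Set where
  self inv rc rc-inv : Symmetry

apply : Symmetry → Permutation′ n → Permutation′ n
apply self   p = p
apply inv    p = flip p
apply rc     p = p ʳᶜ
apply rc-inv p = flip (p ʳᶜ)

module Conditions {n} (q : Permutation′ (suc n)) where
  A B C D : Set
  A = comp q ≥ 3
  B = first₁ q < suc n × comp (q ∖ first q) > comp q
  C = first₁ q > 1 × comp q ≡ 2 × Any BeginsWithLargest (head (components q))
  D = (1 < first₁ q × first₁ q < suc n) × Avoids (q ∖ first q) p213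

  -- q has length suc n, so the bound q₁ < |q| - 1 reads first₁ q < n.
  Extra : Symmetry → Set
  Extra self   = ⊤
  Extra inv    = ⊤
  Extra rc     = first₁ q < n
  Extra rc-inv = first₁ q < n

{-# OPTIONS --safe #-}
module Submission where

-- On a decomposable 1324-avoider, f̃ inserts a fixed point at a cut, i.e. at a boundary between two summands.
-- The entries between two cuts are fixed points, so all cuts give the same result.
--
-- If q has two cuts, it has a fixed point between two summands; deleting it gives π with f(π) = q.
-- Otherwise let r = q ∖ q₁.  If r is decomposable, then q₁ lies beyond the last cut K of r.  Let π be q with its
-- first entry raised by one, so that π differs from q and has the same length.  Then f(π) is π with a new fixed
-- point inserted at K, below the first entry, and deleting that point restores q.  If r is indecomposable, which
-- happens only under (d), the same construction is applied to q₁ + 1 followed by 1 ⊕ r, which contains q.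
--
-- For the reverse-complement, π^rc falls under case (3) unless deleting the last or the largest entry of π leaves
-- a decomposable permutation.  There f(π^rc)^rc is obtained by deleting that entry, inserting a fixed point at a
-- cut of the remainder, and putting the entry back.  Sliding the fixed point through the fixed points between the
-- cuts shows that the result is again f(π), with one exception in which it contains q for a different reason.

open import Defs
open import Data.Nat.Base using (ℕ; zero; suc; _+_; _∸_; _≤_; _<_; _≥_; _>_; z≤n; s≤s; z<s; s<s)
import Data.Nat.Properties as ℕ
open import Data.Fin.Base as Fin
  using (Fin; _↑ˡ_; _↑ʳ_; zero; suc; toℕ; fromℕ; inject₁; fromℕ<; punchIn; punchOut; opposite)
open import Data.Fin.Patterns using (0F; 1F; 2F; 3F)
import Data.Fin.Properties as Fin
open import Data.Fin.Permutation
  using (Permutation′; _⟨$⟩ʳ_; _⟨$⟩ˡ_; id; flip; remove; insert;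
         inverseˡ; inverseʳ; insert-punchIn; insert-remove)
open import Data.List.Base using ([]; _∷_; length; head)
open import Data.List.Relation.Unary.All using (All; []; _∷_)
open import Data.Maybe.Relation.Unary.Any using (Any; just)
open import Data.Product.Base using (Σ-syntax; ∃-syntax; _×_; _,_; proj₁; proj₂)
open import Data.Sum.Base using (_⊎_; inj₁; inj₂)
open import Data.Empty using (⊥; ⊥-elim)
open import Function.Base using (_∘_)
open import Function.Bundles using (mk⇔; Equivalence)
open import Relation.Binary.Definitions using (tri<; tri≈; tri>)
open import Relation.Binary.PropositionalEquality
  using (_≡_; refl; sym; trans; cong; cong₂; subst; subst₂)
open import Relation.Nullary using (¬_; Dec; yes; no)
open import Relation.Nullary.Negation using (contradiction)

private
  variable
    k m n : ℕ

module E = Existence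

-- The library's _≈_ unfolds to a function type from which the permutations cannot be inferred.
infix 4 _≅_
record _≅_ {n} (π ρ : Permutation′ n) : Set where
  constructor pointwise
  field at : ∀ i → π ⟨$⟩ʳ i ≡ ρ ⟨$⟩ʳ i
open _≅_ public

≅-refl : {π : Permutation′ n} → π ≅ π
≅-refl = pointwise λ _ → refl

≅-sym : {π ρ : Permutation′ n} → π ≅ ρ → ρ ≅ π
≅-sym h = pointwise λ i → sym (at h i)

infixr 2 _∙_
_∙_ : {π ρ τ : Permutation′ n} → π ≅ ρ → ρ ≅ τ → π ≅ τ
h ∙ g = pointwise λ i → trans (at h i) (at g i)

to-injective : (π : Permutation′ n) → ∀ {i j} → π ⟨$⟩ʳ i ≡ π ⟨$⟩ʳ j → i ≡ j
to-injective π {i} {j} eq =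
  trans (sym (inverseˡ π)) (trans (cong (π ⟨$⟩ˡ_) eq) (inverseˡ π))

flip-cong : {π ρ : Permutation′ n} → π ≅ ρ → flip π ≅ flip ρ
flip-cong {π = π} {ρ} h = pointwise λ i → to-injective π
  (trans (inverseʳ π) (trans (sym (inverseʳ ρ)) (sym (at h (ρ ⟨$⟩ˡ i)))))

ʳᶜ-cong : {π ρ : Permutation′ n} → π ≅ ρ → π ʳᶜ ≅ ρ ʳᶜ
ʳᶜ-cong h = pointwise λ i → cong opposite (at h (opposite i))

ʳᶜ-involutive : (π : Permutation′ n) → (π ʳᶜ) ʳᶜ ≅ π
ʳᶜ-involutive π = pointwise λ i → trans (Fin.opposite-involutive _)
  (cong (π ⟨$⟩ʳ_) (Fin.opposite-involutive i))

flip-ʳᶜ : (π : Permutation′ n) → flip (π ʳᶜ) ≅ flip π ʳᶜ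
flip-ʳᶜ π = ≅-refl

-- Opposites

opposite-+ : (i : Fin n) → toℕ (opposite i) + suc (toℕ i) ≡ n
opposite-+ {n} i = trans (cong (_+ suc (toℕ i)) (Fin.opposite-prop i))
  (ℕ.m∸n+n≡m (Fin.toℕ<n i))

opposite-unique : ∀ {i j : Fin n} → toℕ j + suc (toℕ i) ≡ n → j ≡ opposite i
opposite-unique {i = i} {j} eq = Fin.toℕ-injective
  (ℕ.+-cancelʳ-≡ (suc (toℕ i)) _ _ (trans eq (sym (opposite-+ i))))

opposite-anti-< : ∀ {i j : Fin n} → toℕ i < toℕ j → toℕ (opposite j) < toℕ (opposite i)
opposite-anti-< {n} {i} {j} i<j =
  ℕ.+-cancelʳ-≤ (suc (toℕ i)) (suc (toℕ (opposite j))) (toℕ (opposite i))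
    (ℕ.≤-trans (ℕ.+-monoʳ-≤ (suc (toℕ (opposite j))) i<j)
      (ℕ.≤-reflexive (trans (sym (ℕ.+-suc (toℕ (opposite j)) (toℕ j)))
        (trans (opposite-+ j) (sym (opposite-+ i))))))

opposite-cancel-< : ∀ {i j : Fin n} → toℕ (opposite i) < toℕ (opposite j) → toℕ j < toℕ i
opposite-cancel-< {i = i} {j} lt = subst₂ (λ x y → toℕ x < toℕ y)
  (Fin.opposite-involutive j) (Fin.opposite-involutive i) (opposite-anti-< lt)

opposite-zero : ∀ {n} (P : Fin (suc n)) → toℕ P ≡ n → opposite P ≡ zero
opposite-zero {n} P eq = sym (opposite-unique (cong suc eq))

-- Punching in

-- `punchIn` on bare numbers, so that places taken from different `Fin` types can be compared.
up : ℕ → ℕ → ℕ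
up zero    j       = suc j
up (suc i) zero    = zero
up (suc i) (suc j) = suc (up i j)

toℕ-punchIn : (i : Fin (suc n)) (j : Fin n) → toℕ (punchIn i j) ≡ up (toℕ i) (toℕ j)
toℕ-punchIn zero    j       = refl
toℕ-punchIn (suc i) zero    = refl
toℕ-punchIn (suc i) (suc j) = cong suc (toℕ-punchIn i j)

up-lo : ∀ {i j} → j < i → up i j ≡ j
up-lo {suc i} {zero}  _         = refl
up-lo {suc i} {suc j} (s<s j<i) = cong suc (up-lo j<i)

up-hi : ∀ {i j} → i ≤ j → up i j ≡ suc j
up-hi {zero}  _                 = refl
up-hi {suc i} {suc j} (s≤s i≤j) = cong suc (up-hi i≤j)

up-mono-< : ∀ i {j k} → j < k → up i j < up i k
up-mono-< zero    lt                      = s<s lt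
up-mono-< (suc i) {zero}  {suc k} lt      = z<s
up-mono-< (suc i) {suc j} {suc k} (s<s l) = s<s (up-mono-< i l)

up-cancel-< : ∀ i {j k} → up i j < up i k → j < k
up-cancel-< zero    (s<s lt)            = lt
up-cancel-< (suc i) {zero}  {suc k} lt  = z<s
up-cancel-< (suc i) {suc j} {suc k} (s<s l) = s<s (up-cancel-< i l)

up<suc : ∀ {i j k} → i ≤ k → j < k → up i j < suc k
up<suc {zero}  z≤n j<k = s<s j<k
up<suc {suc i} {zero} {suc k} (s≤s i≤k) j<k = z<s
up<suc {suc i} {suc j} {suc k} (s≤s i≤k) (s<s j<k) = s<s (up<suc i≤k j<k)

up<suc⁻¹ : ∀ {i j k} → i ≤ k → up i j < suc k → j < k
up<suc⁻¹ {zero}  z≤n (s<s l) = l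
up<suc⁻¹ {suc i} {zero} {suc k} (s≤s i≤k) l = z<s
up<suc⁻¹ {suc i} {suc j} {suc k} (s≤s i≤k) (s<s l) = s<s (up<suc⁻¹ i≤k l)

up< : ∀ {i j k} → k ≤ i → j < k → up i j < k
up< k≤i j<k = subst (_< _) (sym (up-lo (ℕ.<-≤-trans j<k k≤i))) j<k

up<⁻¹ : ∀ {i j k} → k ≤ i → up i j < k → j < k
up<⁻¹ {i} {j} {k} k≤i lt with ℕ.<-≤-connex j i
... | inj₁ j<i = subst (_< k) (up-lo j<i) lt
... | inj₂ i≤j = contradiction (ℕ.<-≤-trans lt (ℕ.≤-trans k≤i i≤j))
                   (ℕ.<-asym (subst (j <_) (sym (up-hi i≤j)) ℕ.≤-refl))

-- Swap a b a′ b′ says that inserting at a and then at b has the same effect as inserting at b′ and then at a′.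
data Swap : ℕ → ℕ → ℕ → ℕ → Set where
  below : ∀ {a b} → a ≤ b → Swap a (suc b) a b
  above : ∀ {a b} → b ≤ a → Swap a b (suc a) b

up-up : ∀ {a b} → a ≤ b → ∀ i → up (suc b) (up a i) ≡ up a (up b i)
up-up {zero}  z≤n       i       = refl
up-up {suc a} (s≤s a≤b) zero    = refl
up-up {suc a} (s≤s a≤b) (suc i) = cong suc (up-up a≤b i)

swap-up : ∀ {a b a′ b′} → Swap a b a′ b′ → ∀ i → up b (up a i) ≡ up a′ (up b′ i)
swap-up (below a≤b) i = up-up a≤b i
swap-up (above b≤a) i = sym (up-up b≤a i)

swap-inner : ∀ {a b a′ b′} → Swap a b a′ b′ → up b a ≡ a′
swap-inner (below a≤b) = up-lo (s≤s a≤b)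
swap-inner (above b≤a) = up-hi b≤a

swap-outer : ∀ {a b a′ b′} → Swap a b a′ b′ → up a′ b′ ≡ b
swap-outer (below a≤b) = up-hi a≤b
swap-outer (above b≤a) = up-lo (s≤s b≤a)

-- Insertion and deletion of a point

data PunchView (i : Fin (suc n)) : Fin (suc n) → Set where
  here  : PunchView i i
  there : ∀ j → PunchView i (punchIn i j)

punchView : (i j : Fin (suc n)) → PunchView i j
punchView i j with i Fin.≟ j
... | yes refl = here
... | no  i≢j  = subst (PunchView i) (Fin.punchIn-punchOut i≢j) (there (punchOut i≢j))

insert-here : ∀ (P V : Fin (suc n)) (π : Permutation′ n) → insert P V π ⟨$⟩ʳ P ≡ V
insert-here P V π with P Fin.≟ P
... | yes _  = refl
... | no P≢P = contradiction refl P≢P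

-- Insertion is treated as a relation: it is stable under pointwise equality, and it can be
-- inverted, reflected and commuted without unfolding a construction.
record Inserted (P V : Fin (suc n)) (π : Permutation′ n) (ρ : Permutation′ (suc n)) : Set where
  constructor inserted
  field
    point : ρ ⟨$⟩ʳ P ≡ V
    rest  : ∀ i → ρ ⟨$⟩ʳ punchIn P i ≡ punchIn V (π ⟨$⟩ʳ i)
open Inserted public

insert-inserted : ∀ (P V : Fin (suc n)) (π : Permutation′ n) → Inserted P V π (insert P V π)
insert-inserted P V π = inserted (insert-here P V π) (insert-punchIn P V π)

-- Sealed copies of insertion and removal: comparing their unfoldings is very slow.
abstract
  insertAt : Fin (suc n) → Fin (suc n) → Permutation′ n → Permutation′ (suc n)
  insertAt = insert

  insertAt-inserted : ∀ (P V : Fin (suc n)) (π : Permutation′ n) → Inserted P V π (insertAt P V π)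
  insertAt-inserted = insert-inserted

inserted-unique : ∀ {P V : Fin (suc n)} {π π′ ρ ρ′} → Inserted P V π ρ → Inserted P V π′ ρ′ →
                  π ≅ π′ → ρ ≅ ρ′
inserted-unique {P = P} {V} {π} {π′} {ρ} {ρ′} I J h = pointwise go
  where
  go : ∀ i → ρ ⟨$⟩ʳ i ≡ ρ′ ⟨$⟩ʳ i
  go i with punchView P i
  ... | here    = trans (point I) (sym (point J))
  ... | there j = trans (rest I j) (trans (cong (punchIn V) (at h j)) (sym (rest J j)))

inserted-base : ∀ {P V : Fin (suc n)} {π π′ ρ ρ′} → Inserted P V π ρ → Inserted P V π′ ρ′ →
                ρ ≅ ρ′ → π ≅ π′
inserted-base {P = P} {V} I J h = pointwise λ i → Fin.punchIn-injective V _ _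
  (trans (sym (rest I i)) (trans (at h (punchIn P i)) (rest J i)))

inserted-≅ : ∀ {P V : Fin (suc n)} {π π′ ρ ρ′} → π ≅ π′ → ρ ≅ ρ′ →
             Inserted P V π ρ → Inserted P V π′ ρ′
inserted-≅ {P = P} {V} h g (inserted p r) = inserted (trans (sym (at g P)) p)
  λ i → trans (sym (at g (punchIn P i))) (trans (r i) (cong (punchIn V) (at h i)))

inserted-remove : ∀ (P : Fin (suc n)) (ρ : Permutation′ (suc n)) →
                  Inserted P (ρ ⟨$⟩ʳ P) (remove P ρ) ρ
inserted-remove P ρ = inserted-≅ ≅-refl (pointwise (insert-remove P ρ)) (insert-inserted _ _ _)

abstract
  removeAt : Fin (suc n) → Permutation′ (suc n) → Permutation′ n
  removeAt = remove

  removeAt-inserted : ∀ (P : Fin (suc n)) (ρ : Permutation′ (suc n)) →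
                      Inserted P (ρ ⟨$⟩ʳ P) (removeAt P ρ) ρ
  removeAt-inserted = inserted-remove

inserted-∖ : ∀ (ρ : Permutation′ (suc n)) (e : Fin (suc n)) → Inserted (ρ ⟨$⟩ˡ e) e (ρ ∖ e) ρ
inserted-∖ ρ e = subst (λ v → Inserted (ρ ⟨$⟩ˡ e) v (ρ ∖ e) ρ) (inverseʳ ρ)
  (inserted-remove (ρ ⟨$⟩ˡ e) ρ)

∖-inserted : ∀ {P V : Fin (suc n)} {π ρ} → Inserted P V π ρ → ρ ∖ V ≅ π
∖-inserted {P = P} {V} {π} {ρ} I = inserted-base
  (subst (λ p → Inserted p V (ρ ∖ V) ρ)
    (trans (cong (ρ ⟨$⟩ˡ_) (sym (point I))) (inverseˡ ρ)) (inserted-∖ ρ V)) I ≅-refl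

inserted-flip : ∀ {P V : Fin (suc n)} {π ρ} → Inserted P V π ρ → Inserted V P (flip π) (flip ρ)
inserted-flip {P = P} {V} {π} {ρ} I = inserted
  (to-injective ρ (trans (inverseʳ ρ) (sym (point I))))
  (λ i → to-injective ρ (trans (inverseʳ ρ)
    (sym (trans (rest I _) (cong (punchIn V) (inverseʳ π))))))

-- Reflection exchanges the elements below the gap with those above it, so the two branches of `up`
-- change places.
opposite-punchIn : (i : Fin (suc n)) (j : Fin n) →
                   opposite (punchIn i j) ≡ punchIn (opposite i) (opposite j)
opposite-punchIn {n} i j = sym (opposite-unique (trans (cong₂ (λ x y → x + suc y)
    (toℕ-punchIn (opposite i) (opposite j)) (toℕ-punchIn i j)) (go (ℕ.<-≤-connex (toℕ j) (toℕ i)))))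
  where
  go : toℕ j < toℕ i ⊎ toℕ i ≤ toℕ j →
       up (toℕ (opposite i)) (toℕ (opposite j)) + suc (up (toℕ i) (toℕ j)) ≡ suc n
  go (inj₁ j<i) rewrite up-lo j<i = trans (cong (_+ suc (toℕ j)) (up-hi (ℕ.+-cancelʳ-≤ (suc (toℕ j)) _ _
      (ℕ.≤-pred (ℕ.≤-trans (ℕ.≤-reflexive (sym (ℕ.+-suc _ (suc (toℕ j)))))
      (ℕ.≤-trans (ℕ.+-monoʳ-≤ (toℕ (opposite i)) (s≤s j<i)) (ℕ.≤-reflexive (trans (opposite-+ i) (cong suc
          (sym (opposite-+ j)))))))))))
    (cong suc (opposite-+ j))
  go (inj₂ i≤j) rewrite up-hi i≤j = trans (cong (_+ suc (suc (toℕ j))) (up-lo (ℕ.+-cancelʳ-≤ (suc (toℕ i)) _ _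
      (ℕ.≤-trans (s≤s (ℕ.+-monoʳ-≤ (toℕ (opposite j)) (s≤s i≤j)))
        (ℕ.≤-reflexive (trans (cong suc (opposite-+ j)) (sym (opposite-+ i))))))))
    (trans (ℕ.+-suc _ _) (cong suc (opposite-+ j)))

inserted-ʳᶜ : ∀ {P V : Fin (suc n)} {π ρ} → Inserted P V π ρ →
              Inserted (opposite P) (opposite V) (π ʳᶜ) (ρ ʳᶜ)
inserted-ʳᶜ {P = P} {V} {π} {ρ} I = inserted
  (cong opposite (trans (cong (ρ ⟨$⟩ʳ_) (Fin.opposite-involutive P)) (point I)))
  (λ i → trans (cong (λ j → opposite (ρ ⟨$⟩ʳ j))
      (trans (opposite-punchIn (opposite P) i) (cong (λ x → punchIn x (opposite i)) (Fin.opposite-involutive P))))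
    (trans (cong opposite (rest I (opposite i))) (opposite-punchIn V _)))

-- Two insertions commute once their coordinates are adjusted. Positions and values are adjusted
-- independently, hence one `Swap` for each. All later comparisons of permutations that differ by
-- two points rest on this.
inserted-swap : ∀ {P V : Fin (suc n)} {P′ V′ : Fin (suc n)}
                {Q W : Fin (suc (suc n))} {Q′ W′ : Fin (suc (suc n))} {π ρ ρ′ τ} →
                Inserted P V π ρ → Inserted Q W ρ τ →
                Swap (toℕ P) (toℕ Q) (toℕ Q′) (toℕ P′) →
                Swap (toℕ V) (toℕ W) (toℕ W′) (toℕ V′) →
                Inserted P′ V′ π ρ′ → Inserted Q′ W′ ρ′ τ
inserted-swap {n = n} {P} {V} {P′} {V′} {Q} {W} {Q′} {W′} {π} {ρ} {ρ′} {τ} I J s t I′ =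
  inserted (trans (cong (τ ⟨$⟩ʳ_) (sym (inner s))) (trans (rest J P)
              (trans (cong (punchIn W) (point I)) (inner t)))) go
  where
  inner : ∀ {A A′ : Fin (suc n)} {B B′ : Fin (suc (suc n))} →
          Swap (toℕ A) (toℕ B) (toℕ B′) (toℕ A′) → punchIn B A ≡ B′
  inner {A} {A′} {B} s = Fin.toℕ-injective (trans (toℕ-punchIn B A) (swap-inner s))

  outer : ∀ {A A′ : Fin (suc n)} {B B′ : Fin (suc (suc n))} →
          Swap (toℕ A) (toℕ B) (toℕ B′) (toℕ A′) → punchIn B′ A′ ≡ B
  outer {A} {A′} {B} {B′} s = Fin.toℕ-injective (trans (toℕ-punchIn B′ A′) (swap-outer s))

  both : ∀ {A A′ : Fin (suc n)} {B B′ : Fin (suc (suc n))} →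
         Swap (toℕ A) (toℕ B) (toℕ B′) (toℕ A′) → ∀ i →
         punchIn B (punchIn A i) ≡ punchIn B′ (punchIn A′ i)
  both {A} {A′} {B} {B′} s i = Fin.toℕ-injective (
    trans (toℕ-punchIn B (punchIn A i)) (trans (cong (up (toℕ B)) (toℕ-punchIn A i))
    (trans (swap-up s (toℕ i)) (sym (trans (toℕ-punchIn B′ (punchIn A′ i)) (cong (up (toℕ B′))
        (toℕ-punchIn A′ i)))))))

  go : ∀ i → τ ⟨$⟩ʳ punchIn Q′ i ≡ punchIn W′ (ρ′ ⟨$⟩ʳ i)
  go i with punchView P′ i
  ... | here    = trans (cong (τ ⟨$⟩ʳ_) (outer s)) (trans (point J)
                    (sym (trans (cong (punchIn W′) (point I′)) (outer t))))
  ... | there j = trans (cong (τ ⟨$⟩ʳ_) (sym (both s j))) (trans (rest J _)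
                    (trans (cong (punchIn W) (rest I j)) (trans (both t _)
                      (cong (punchIn W′) (sym (rest I′ j))))))

-- Pattern containment

increasing : ∀ {n} (f : Fin (suc n) → ℕ) → (∀ (i : Fin n) → f (inject₁ i) < f (suc i)) →
             ∀ i j → i Fin.< j → f i < f j
increasing {suc n} f h zero    (suc zero)    _         = h zero
increasing {suc n} f h zero    (suc (suc j)) _         =
  ℕ.<-trans (h zero) (increasing (f ∘ suc) (h ∘ suc) zero (suc j) z<s)
increasing {suc n} f h (suc i) (suc j)       (s<s i<j) = increasing (f ∘ suc) (h ∘ suc) i j i<j

-- Neighbouring positions and neighbouring values suffice by transitivity; the converse comparison
-- of values follows from trichotomy.
contains : (π : Permutation′ n) (p : Permutation′ (suc k)) (e : Fin (suc k) → Fin n) →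
           (∀ (i : Fin k) → e (inject₁ i) Fin.< e (suc i)) →
           (∀ (v : Fin k) → π ⟨$⟩ʳ e (p ⟨$⟩ˡ inject₁ v) Fin.< π ⟨$⟩ʳ e (p ⟨$⟩ˡ suc v)) →
           Contains π p
contains π p e positions values = e , increasing (toℕ ∘ e) positions , λ i j → mk⇔ (back i j) (forth i j)
  where
  forth : ∀ i j → p ⟨$⟩ʳ i Fin.< p ⟨$⟩ʳ j → π ⟨$⟩ʳ e i Fin.< π ⟨$⟩ʳ e j
  forth i j lt = subst₂ (λ x y → π ⟨$⟩ʳ e x Fin.< π ⟨$⟩ʳ e y) (inverseˡ p) (inverseˡ p)
    (increasing (λ v → toℕ (π ⟨$⟩ʳ e (p ⟨$⟩ˡ v))) values _ _ lt)
  back : ∀ i j → π ⟨$⟩ʳ e i Fin.< π ⟨$⟩ʳ e j → p ⟨$⟩ʳ i Fin.< p ⟨$⟩ʳ j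
  back i j lt with Fin.<-cmp (p ⟨$⟩ʳ i) (p ⟨$⟩ʳ j)
  ... | tri< l _ _ = l
  ... | tri≈ _ eq _ rewrite to-injective p eq = contradiction lt (ℕ.<-irrefl refl)
  ... | tri> _ _ g = contradiction lt (ℕ.<-asym (forth j i g))

contains-trans : ∀ (π : Permutation′ n) (ρ : Permutation′ m) (p : Permutation′ k) →
                 Contains π ρ → Contains ρ p → Contains π p
contains-trans π ρ p (e , mono , iff) (e′ , mono′ , iff′) =
  e ∘ e′ , (λ i j lt → mono _ _ (mono′ i j lt)) , λ i j → mk⇔
    (Equivalence.to (iff′ i j) ∘ Equivalence.to (iff (e′ i) (e′ j)))
    (Equivalence.from (iff (e′ i) (e′ j)) ∘ Equivalence.from (iff′ i j))

contains-≅ : ∀ {π ρ : Permutation′ n} → π ≅ ρ → Contains π ρ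
contains-≅ {π = π} {ρ} h = (λ i → i) , (λ i j lt → lt) , λ i j →
  mk⇔ (subst₂ Fin._<_ (at h i) (at h j)) (subst₂ Fin._<_ (sym (at h i)) (sym (at h j)))

contains-inserted : ∀ {P V : Fin (suc n)} {π ρ} → Inserted P V π ρ → Contains ρ π
contains-inserted {P = P} {V} {π} {ρ} I = punchIn P ,
  (λ i j lt → subst₂ _<_ (sym (toℕ-punchIn P i)) (sym (toℕ-punchIn P j)) (up-mono-< (toℕ P) lt)) ,
  λ i j → mk⇔
    (λ lt → up-cancel-< (toℕ V) (subst₂ _<_ (value i) (value j) lt))
    (λ lt → subst₂ _<_ (sym (value i)) (sym (value j)) (up-mono-< (toℕ V) lt))
  where
  value : ∀ i → toℕ (ρ ⟨$⟩ʳ punchIn P i) ≡ up (toℕ V) (toℕ (π ⟨$⟩ʳ i))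
  value i = trans (cong toℕ (rest I i)) (toℕ-punchIn V _)

strictly-monotone-reflects : (e : Fin k → Fin n) → (∀ i j → i Fin.< j → e i Fin.< e j) →
                             ∀ i j → e i Fin.< e j → i Fin.< j
strictly-monotone-reflects e mono i j lt with Fin.<-cmp i j
... | tri< l _ _    = l
... | tri≈ _ refl _ = contradiction lt (ℕ.<-irrefl refl)
... | tri> _ _ g    = contradiction lt (ℕ.<-asym (mono j i g))

-- The values of the given occurrence, listed in increasing order, are the positions of the inverse
-- occurrence.
contains-flip : ∀ (π : Permutation′ n) (p : Permutation′ k) → Contains π p → Contains (flip π) (flip p)
contains-flip π p (e , mono , iff) =
  (λ i → π ⟨$⟩ʳ e (p ⟨$⟩ˡ i)) ,
  (λ i j lt → Equivalence.from (iff _ _) (subst₂ Fin._<_ (sym (inverseʳ p)) (sym (inverseʳ p)) lt)) ,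
  λ i j → mk⇔
    (λ lt → strictly-monotone-reflects e mono _ _ (subst₂ Fin._<_ (inverseˡ π) (inverseˡ π) lt))
    (λ lt → subst₂ Fin._<_ (sym (inverseˡ π)) (sym (inverseˡ π)) (mono _ _ lt))

contains-ʳᶜ : ∀ (π : Permutation′ n) (p : Permutation′ k) → Contains π p → Contains (π ʳᶜ) (p ʳᶜ)
contains-ʳᶜ π p (e , mono , iff) =
  (λ i → opposite (e (opposite i))) ,
  (λ i j lt → opposite-anti-< (mono _ _ (opposite-anti-< lt))) ,
  λ i j → mk⇔
    (λ lt → opposite-anti-< (Equivalence.to (iff _ _) (subst₂ Fin._<_
      (cong (π ⟨$⟩ʳ_) (Fin.opposite-involutive _)) (cong (π ⟨$⟩ʳ_) (Fin.opposite-involutive _))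
      (opposite-cancel-< lt))))
    (λ lt → opposite-anti-< (subst₂ Fin._<_
      (cong (π ⟨$⟩ʳ_) (sym (Fin.opposite-involutive _))) (cong (π ⟨$⟩ʳ_) (sym (Fin.opposite-involutive _)))
      (Equivalence.from (iff _ _) (opposite-cancel-< lt))))

embedding-gap : ∀ (e : Fin (suc k) → Fin n) → (∀ i j → i Fin.< j → e i Fin.< e j) →
                ∀ i → toℕ (e zero) + toℕ i ≤ toℕ (e i)
embedding-gap e mono i = go (toℕ i) i refl
  where
  go : ∀ v i → toℕ i ≡ v → toℕ (e zero) + v ≤ toℕ (e i)
  go zero    zero    _  = ℕ.≤-reflexive (ℕ.+-identityʳ _)
  go (suc v) (suc i) eq = subst (_≤ toℕ (e (suc i))) (sym (ℕ.+-suc (toℕ (e zero)) v)) (ℕ.≤-<-trans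
    (go v (inject₁ i) (trans (Fin.toℕ-inject₁ i) (ℕ.suc-injective eq)))
    (mono (inject₁ i) (suc i) (s≤s (ℕ.≤-reflexive (Fin.toℕ-inject₁ i)))))

embedding-≥ : ∀ (e : Fin k → Fin n) → (∀ i j → i Fin.< j → e i Fin.< e j) → ∀ i → toℕ i ≤ toℕ (e i)
embedding-≥ {suc k} e mono i = ℕ.≤-trans (ℕ.m≤n+m (toℕ i) (toℕ (e zero))) (embedding-gap e mono i)

-- This is `embedding-≥` for the embedding read from the opposite end.
embedding-≤ : ∀ (e : Fin k → Fin n) → (∀ i j → i Fin.< j → e i Fin.< e j) →
              ∀ i → toℕ (e i) + k ≤ toℕ i + n
embedding-≤ {k} {n} e mono i = subst₂ _≤_
  (trans (sym (shuffle (toℕ (e i)) _ (toℕ i))) (cong (toℕ (e i) +_) (opposite-+ i)))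
  (trans (cong (λ x → toℕ (opposite (e i)) + suc x) (ℕ.+-comm (toℕ (e i)) (toℕ i)))
    (trans (sym (shuffle (toℕ i) _ (toℕ (e i)))) (cong (toℕ i +_) (opposite-+ (e i)))))
  (ℕ.+-monoˡ-≤ (suc (toℕ (e i) + toℕ i)) bound)
  where
  shuffle : ∀ a b c → a + (b + suc c) ≡ b + suc (a + c)
  shuffle a b c = trans (sym (ℕ.+-assoc a b (suc c))) (trans (cong (_+ suc c) (ℕ.+-comm a b))
    (trans (ℕ.+-assoc b a (suc c)) (cong (b +_) (ℕ.+-suc a c))))
  bound : toℕ (opposite i) ≤ toℕ (opposite (e i))
  bound = subst (λ j → toℕ (opposite i) ≤ toℕ (opposite (e j))) (Fin.opposite-involutive i)
    (embedding-≥ (opposite ∘ e ∘ opposite)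
      (λ i j lt → opposite-anti-< (mono _ _ (opposite-anti-< lt))) (opposite i))

contains-length : ∀ (π : Permutation′ n) (p : Permutation′ (suc k)) → Contains π p → suc k ≤ n
contains-length {n} {k} π p (e , mono , _) = ℕ.+-cancelˡ-≤ (toℕ (e zero)) _ _
  (ℕ.≤-trans (embedding-≤ e mono zero) (ℕ.m≤n+m n (toℕ (e zero))))

-- Avoidance of 1324 in terms of four positions, so that no embedding has to be assembled each time.
record Free (π : Permutation′ n) : Set where
  constructor free
  field no1324 : ∀ {a b c d} → a Fin.< b → b Fin.< c → c Fin.< d →
                 π ⟨$⟩ʳ a Fin.< π ⟨$⟩ʳ c → π ⟨$⟩ʳ c Fin.< π ⟨$⟩ʳ b → π ⟨$⟩ʳ b Fin.< π ⟨$⟩ʳ d → ⊥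
open Free public

avoids⇒free : {π : Permutation′ n} → Avoids π p1324 → Free π
avoids⇒free {π = π} av = free λ {a} {b} {c} {d} ab bc cd va vc vb → av (contains π p1324
  (λ { 0F → a ; 1F → b ; 2F → c ; 3F → d })
  (λ { 0F → ab ; 1F → bc ; 2F → cd })
  (λ { 0F → va ; 1F → vc ; 2F → vb }))

free⇒avoids : {π : Permutation′ n} → Free π → Avoids π p1324
free⇒avoids fr (e , mono , iff) = no1324 fr
  (mono 0F 1F z<s) (mono 1F 2F (s<s z<s)) (mono 2F 3F (s<s (s<s z<s)))
  (Equivalence.from (iff 0F 2F) z<s) (Equivalence.from (iff 2F 1F) (s<s z<s))
  (Equivalence.from (iff 1F 3F) (s<s (s<s z<s)))

free-contained : {π : Permutation′ n} {ρ : Permutation′ m} → Contains π ρ → Free π → Free ρ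
free-contained (e , mono , iff) fr = free λ ab bc cd va vc vb →
  no1324 fr (mono _ _ ab) (mono _ _ bc) (mono _ _ cd)
    (Equivalence.from (iff _ _) va) (Equivalence.from (iff _ _) vc) (Equivalence.from (iff _ _) vb)

free-flip : {π : Permutation′ n} → Free π → Free (flip π)
free-flip {π = π} fr = free λ ab bc cd va vc vb → no1324 fr va vc vb (v ab) (v bc) (v cd)
  where
  v : ∀ {a b} → a Fin.< b → π ⟨$⟩ʳ (π ⟨$⟩ˡ a) Fin.< π ⟨$⟩ʳ (π ⟨$⟩ˡ b)
  v = subst₂ Fin._<_ (sym (inverseʳ π)) (sym (inverseʳ π))

free-ʳᶜ : {π : Permutation′ n} → Free π → Free (π ʳᶜ)
free-ʳᶜ fr = free λ ab bc cd va vc vb → no1324 fr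
  (opposite-anti-< cd) (opposite-anti-< bc) (opposite-anti-< ab)
  (opposite-cancel-< vb) (opposite-cancel-< vc) (opposite-cancel-< va)

-- Cuts

-- A decomposition into two nonempty summands, given by the length of the first one.
record Cut (k : ℕ) (π : Permutation′ n) : Set where
  constructor cut
  field
    pos    : 0 < k
    bound  : k < n
    closed : E.Closed k π
open Cut public

module _ {π : Permutation′ n} {k : ℕ} (c : E.Closed k π) where
  closed-< : ∀ {i} → toℕ i < k → toℕ (π ⟨$⟩ʳ i) < k
  closed-< {i} = proj₁ (c i)
  closed-<⁻¹ : ∀ {i} → toℕ (π ⟨$⟩ʳ i) < k → toℕ i < k
  closed-<⁻¹ {i} = proj₂ (c i)
  closed-≥ : ∀ {i} → k ≤ toℕ i → k ≤ toℕ (π ⟨$⟩ʳ i)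
  closed-≥ le = ℕ.≮⇒≥ λ lt → ℕ.<⇒≱ (closed-<⁻¹ lt) le

closed-≅ : ∀ {π ρ : Permutation′ n} → π ≅ ρ → E.Closed k π → E.Closed k ρ
closed-≅ {k = k} {π} {ρ} h = E.closed-≈ k {ρ} {π} (at (≅-sym h))

closed-ʳᶜ : ∀ {π : Permutation′ n} → k ≤ n → E.Closed k π → E.Closed (n ∸ k) (π ʳᶜ)
closed-ʳᶜ {n} {k} {π} k≤n c i =
  (λ lt → out (closed-≥ {π = π} c (into lt))) ,
  (λ lt → subst (λ j → toℕ j < n ∸ k) (Fin.opposite-involutive i)
    (out (ℕ.≮⇒≥ λ l → ℕ.<⇒≱ (closed-< {π = π} c l)
      (subst (λ j → k ≤ toℕ j) (Fin.opposite-involutive _) (into lt)))))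
  where
  into : ∀ {i : Fin n} → toℕ i < n ∸ k → k ≤ toℕ (opposite i)
  into {i} lt = subst (k ≤_) (sym (Fin.opposite-prop i))
    (subst (_≤ n ∸ suc (toℕ i)) (ℕ.m∸[m∸n]≡n k≤n) (ℕ.∸-monoʳ-≤ n lt))
  out : ∀ {i : Fin n} → k ≤ toℕ i → toℕ (opposite i) < n ∸ k
  out {i} le = subst (_< n ∸ k) (sym (Fin.opposite-prop i)) (ℕ.∸-monoʳ-< (s≤s le) (Fin.toℕ<n i))

cut-≅ : {π ρ : Permutation′ n} → π ≅ ρ → Cut k π → Cut k ρ
cut-≅ h (cut p b c) = cut p b (closed-≅ h c)

cut-flip : {π : Permutation′ n} → Cut k π → Cut k (flip π)
cut-flip {k = k} {π} (cut p b c) = cut p b (E.closed-flip k π c)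

cut-ʳᶜ : {π : Permutation′ n} → Cut k π → Cut (n ∸ k) (π ʳᶜ)
cut-ʳᶜ {n} {k} {π} (cut p b c) = cut (ℕ.m<n⇒0<n∸m b) (ℕ.∸-monoʳ-< p (ℕ.<⇒≤ b))
  (closed-ʳᶜ {π = π} (ℕ.<⇒≤ b) c)

decomposable⇒cut : {π : Permutation′ n} → Decomposable π → ∃[ k ] Cut k π
decomposable⇒cut {zero} (a , b , _ , _ , () , _)
decomposable⇒cut {suc n} {π} d with E.decomposable⇒closed π d
... | a , a<n , c = suc a , cut z<s (s<s a<n) c

cut⇒decomposable : {π : Permutation′ n} → Cut k π → Decomposable π
cut⇒decomposable {n} {suc a} {π} (cut _ b c) with n ∸ suc a in eq | ℕ.m+[n∸m]≡n (ℕ.<⇒≤ b)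
... | zero  | _    = contradiction (ℕ.m∸n≡0⇒m≤n eq) (ℕ.<⇒≱ b)
... | suc r | refl = let σ , τ , h = E.Split.split (suc a) π c in
  a , r , σ , τ , E.≈⇒≋ {π = π} {σ ⊕ τ} h

cut? : ∀ k (π : Permutation′ n) → Dec (Cut k π)
cut? {n} k π with 0 ℕ.<? k | k ℕ.<? n | E.closed? k π
... | yes p | yes b | yes c = yes (cut p b c)
... | no ¬p | _     | _     = no λ x → ¬p (pos x)
... | yes _ | no ¬b | _     = no λ x → ¬b (bound x)
... | yes _ | yes _ | no ¬c = no λ x → ¬c (closed x)

record LastCut (K : ℕ) (π : Permutation′ n) : Set where
  constructor lastCut
  field
    isCut : Cut K π
    max   : ∀ {j} → Cut j π → j ≤ K
open LastCut public

lastCut? : (π : Permutation′ n) → (∃[ K ] LastCut K π) ⊎ (∀ {k} → ¬ Cut k π)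
lastCut? {n} π with search n
  where
  search : ∀ m → (∃[ K ] Cut K π × (∀ {j} → j < m → Cut j π → j ≤ K)) ⊎ (∀ {j} → j < m → ¬ Cut j π)
  search zero = inj₂ λ ()
  search (suc m) with cut? m π
  ... | yes c = inj₁ (m , c , λ j<m _ → ℕ.≤-pred j<m)
  ... | no ¬c with search m
  ...   | inj₁ (K , c , max) = inj₁ (K , c , λ {j} j<sm cj → max (strict j<sm cj) cj)
    where
    strict : ∀ {j} → j < suc m → Cut j π → j < m
    strict {j} j<sm cj = ℕ.≤∧≢⇒< (ℕ.≤-pred j<sm) λ { refl → ¬c cj }
  ...   | inj₂ none = inj₂ λ {j} j<sm cj → none (ℕ.≤∧≢⇒< (ℕ.≤-pred j<sm) λ { refl → ¬c cj }) cj
... | inj₁ (K , c , max) = inj₁ (K , lastCut c λ cj → max (bound cj) cj)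
... | inj₂ none = inj₂ λ c → none (bound c) c

decomposable? : (π : Permutation′ n) → Dec (Decomposable π)
decomposable? π with lastCut? π
... | inj₁ (_ , c) = yes (cut⇒decomposable (isCut c))
... | inj₂ none    = no λ d → none (proj₂ (decomposable⇒cut {π = π} d))

-- Cuts and insertion

module _ {P V : Fin (suc n)} {π : Permutation′ n} {ρ : Permutation′ (suc n)} (I : Inserted P V π ρ) where
  private
    value : ∀ i → toℕ (ρ ⟨$⟩ʳ punchIn P i) ≡ up (toℕ V) (toℕ (π ⟨$⟩ʳ i))
    value i = trans (cong toℕ (rest I i)) (toℕ-punchIn V _)
    position : ∀ i → toℕ (punchIn P i) ≡ up (toℕ P) (toℕ i)
    position i = toℕ-punchIn P i

  closed-inserted-above⁻¹ : k ≤ toℕ P → k ≤ toℕ V → E.Closed k ρ → E.Closed k π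
  closed-inserted-above⁻¹ {k} p v c j with c (punchIn P j)
  ... | f , g rewrite value j | position j =
    (λ lt → up<⁻¹ v (f (up< p lt))) , (λ lt → up<⁻¹ p (g (up< v lt)))

  closed-inserted-below : toℕ P ≤ k → toℕ V ≤ k → E.Closed k π → E.Closed (suc k) ρ
  closed-inserted-below {k} p v c i with punchView P i
  ... | here = (λ _ → subst (λ x → toℕ x < suc k) (sym (point I)) (s≤s v)) , (λ _ → s≤s p)
  ... | there j rewrite value j | position j =
    (λ lt → up<suc v (proj₁ (c j) (up<suc⁻¹ p lt))) , (λ lt → up<suc p (proj₂ (c j) (up<suc⁻¹ v lt)))

  closed-inserted-below⁻¹ : toℕ P ≤ k → toℕ V ≤ k → E.Closed (suc k) ρ → E.Closed k π
  closed-inserted-below⁻¹ {k} p v c j with c (punchIn P j)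
  ... | f , g rewrite value j | position j =
    (λ lt → up<suc⁻¹ v (f (up<suc p lt))) , (λ lt → up<suc⁻¹ p (g (up<suc v lt)))

-- Fixed points between two cuts

record Fixed (A B : ℕ) (π : Permutation′ n) : Set where
  constructor fixed
  field fix : ∀ {i} → A ≤ toℕ i → toℕ i < B → π ⟨$⟩ʳ i ≡ i
open Fixed public

-- Induction upwards from A shows that no entry lies below the diagonal, and induction downwards
-- from B that none lies above it.
increasing⇒fixed : ∀ {A B} (π : Permutation′ n) → B ≤ n → E.Closed A π → E.Closed B π →
  (∀ {i j} → A ≤ toℕ i → i Fin.< j → toℕ j < B → π ⟨$⟩ʳ i Fin.< π ⟨$⟩ʳ j) → Fixed A B π
increasing⇒fixed {n} {A} {B} π B≤n cA cB inc = fixed λ {i} A≤i i<B → Fin.toℕ-injective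
  (ℕ.≤-antisym (above-diagonal (B ∸ suc (toℕ i)) i (trans (ℕ.+-suc (toℕ i) _) (ℕ.m+[n∸m]≡n i<B)) A≤i)
    (below-diagonal (toℕ i) i refl A≤i i<B))
  where
  below-diagonal : ∀ v i → toℕ i ≡ v → A ≤ toℕ i → toℕ i < B → v ≤ toℕ (π ⟨$⟩ʳ i)
  below-diagonal zero    i       eq A≤i i<B = z≤n
  below-diagonal (suc v) (suc i) eq A≤i i<B with ℕ.<-≤-connex (toℕ i) A
  ... | inj₁ i<A = ℕ.≤-trans (ℕ.≤-trans (ℕ.≤-reflexive (sym eq)) i<A) (closed-≥ {π = π} cA A≤i)
  ... | inj₂ A≤i′ = ℕ.≤-<-trans
    (below-diagonal v (inject₁ i) (trans (Fin.toℕ-inject₁ i) (ℕ.suc-injective eq))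
      (subst (A ≤_) (sym (Fin.toℕ-inject₁ i)) A≤i′)
      (subst (_< B) (sym (Fin.toℕ-inject₁ i)) (ℕ.<-trans (ℕ.n<1+n _) i<B)))
    (inc (subst (A ≤_) (sym (Fin.toℕ-inject₁ i)) A≤i′) (s≤s (ℕ.≤-reflexive (Fin.toℕ-inject₁ i))) i<B)

  above-diagonal : ∀ v i → toℕ i + suc v ≡ B → A ≤ toℕ i → toℕ (π ⟨$⟩ʳ i) ≤ toℕ i
  above-diagonal zero i eq A≤i = ℕ.≤-pred (subst (toℕ (π ⟨$⟩ʳ i) <_) B≡ (closed-< {π = π} cB
      (ℕ.≤-reflexive (sym B≡))))
    where
    B≡ : B ≡ suc (toℕ i)
    B≡ = trans (sym eq) (ℕ.+-comm (toℕ i) 1)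
  above-diagonal (suc v) i eq A≤i = ℕ.≤-pred (ℕ.<-≤-trans
    (inc A≤i (ℕ.≤-reflexive (sym toℕ-j)) (subst (_< B) (sym toℕ-j) lt))
    (ℕ.≤-trans (above-diagonal v j (trans (cong (_+ suc v) toℕ-j) eq′)
      (subst (A ≤_) (sym toℕ-j) (ℕ.m≤n⇒m≤1+n A≤i))) (ℕ.≤-reflexive toℕ-j)))
    where
    eq′ : suc (toℕ i) + suc v ≡ B
    eq′ = trans (sym (ℕ.+-suc (toℕ i) (suc v))) eq
    lt : suc (toℕ i) < B
    lt = subst (suc (toℕ i) <_) eq′ (ℕ.m<m+n _ z<s)
    j : Fin n
    j = fromℕ< (ℕ.<-≤-trans lt B≤n)
    toℕ-j : toℕ j ≡ suc (toℕ i)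
    toℕ-j = Fin.toℕ-fromℕ< _

-- The first entry lies below everything after the cut A, and the last entry above everything before
-- the cut B. They would complete an inversion between the cuts to a 1324.
free⇒fixed : ∀ {A B} {π : Permutation′ n} → Free π → Cut A π → Cut B π → Fixed A B π
free⇒fixed {n = zero} _ (cut _ () _) _
free⇒fixed {n = suc n} {A} {B} {π} fr cA cB = increasing⇒fixed π (ℕ.<⇒≤ (bound cB)) (closed cA) (closed cB) inc
  where
  inc : ∀ {i j} → A ≤ toℕ i → i Fin.< j → toℕ j < B → π ⟨$⟩ʳ i Fin.< π ⟨$⟩ʳ j
  inc {i} {j} A≤i i<j j<B with Fin.<-cmp (π ⟨$⟩ʳ i) (π ⟨$⟩ʳ j)
  ... | tri< l _ _  = l
  ... | tri≈ _ eq _ rewrite to-injective π eq = contradiction i<j (ℕ.<-irrefl refl)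
  ... | tri> _ _ g  = ⊥-elim (no1324 fr {zero} {i} {j} {fromℕ n}
    (ℕ.<-≤-trans (pos cA) A≤i) i<j (ℕ.<-≤-trans j<B B≤top)
    (ℕ.<-≤-trans (closed-< {π = π} (closed cA) (pos cA))
      (closed-≥ {π = π} (closed cA) (ℕ.≤-trans A≤i (ℕ.<⇒≤ i<j))))
    g (ℕ.<-≤-trans (closed-< {π = π} (closed cB) (ℕ.<-trans i<j j<B)) (closed-≥ {π = π} (closed cB) B≤top)))
    where
    B≤top : B ≤ toℕ (fromℕ n)
    B≤top = subst (B ≤_) (sym (Fin.toℕ-fromℕ n)) (ℕ.≤-pred (bound cB))

fixed-closed : ∀ {A B x} {π : Permutation′ n} → E.Closed A π → Fixed A B π → A ≤ x → x ≤ B → E.Closed x π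
fixed-closed {A = A} {B} {x} {π} c f A≤x x≤B i = to , from
  where
  to : toℕ i < x → toℕ (π ⟨$⟩ʳ i) < x
  to i<x with ℕ.<-≤-connex (toℕ i) A
  ... | inj₁ i<A = ℕ.<-≤-trans (closed-< {π = π} c i<A) A≤x
  ... | inj₂ A≤i = subst (λ j → toℕ j < x) (sym (fix f A≤i (ℕ.<-≤-trans i<x x≤B))) i<x
  from : toℕ (π ⟨$⟩ʳ i) < x → toℕ i < x
  from v<x with ℕ.<-≤-connex (toℕ (π ⟨$⟩ʳ i)) A
  ... | inj₁ v<A = ℕ.<-≤-trans (closed-<⁻¹ {π = π} c v<A) A≤x
  ... | inj₂ A≤v = subst (λ j → toℕ j < x) (to-injective π (fix f A≤v (ℕ.<-≤-trans v<x x≤B))) v<x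

-- The map f̃ as insertion of a fixed point

-- A form of f̃ without summands: the new fixed point may be placed at any cut. This makes the
-- symmetries evident and leaves the choice of the cut free.
record Grows (π : Permutation′ n) (ρ : Permutation′ (suc n)) : Set where
  constructor grows
  field
    place    : Fin (suc n)
    added    : Inserted place place π ρ
    cutThere : Cut (toℕ place) π
    isFree   : Free π
open Grows public

grows-≅ : {π π′ : Permutation′ n} {ρ ρ′ : Permutation′ (suc n)} → π ≅ π′ → ρ ≅ ρ′ → Grows π ρ → Grows π′ ρ′
grows-≅ h g (grows k I c fr) =
  grows k (inserted-≅ h g I) (cut-≅ h c) (free-contained (contains-≅ h) fr)

grows-flip : {π : Permutation′ n} {ρ : Permutation′ (suc n)} → Grows π ρ → Grows (flip π) (flip ρ)
grows-flip (grows k I c fr) = grows k (inserted-flip I) (cut-flip c) (free-flip fr)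

grows-ʳᶜ : {π : Permutation′ n} {ρ : Permutation′ (suc n)} → Grows π ρ → Grows (π ʳᶜ) (ρ ʳᶜ)
grows-ʳᶜ {π = π} (grows k I c fr) = grows (opposite k) (inserted-ʳᶜ I)
  (subst (λ x → Cut x (π ʳᶜ)) (sym (Fin.opposite-prop k)) (cut-ʳᶜ c)) (free-ʳᶜ fr)

-- A point with numerical coordinates, so that permutations whose lengths agree only propositionally
-- can be compared.
record Graph (π : Permutation′ n) (i v : ℕ) : Set where
  constructor graph
  field
    arg      : Fin n
    position : toℕ arg ≡ i
    value    : toℕ (π ⟨$⟩ʳ arg) ≡ v

graph-at : (π : Permutation′ n) (i : Fin n) → Graph π (toℕ i) (toℕ (π ⟨$⟩ʳ i))
graph-at π i = graph i refl refl

graph-≅ : ∀ {π ρ : Permutation′ n} {i v} → π ≅ ρ → Graph π i v → Graph ρ i v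
graph-≅ h (graph a p w) = graph a p (trans (cong toℕ (sym (at h a))) w)

-- One inclusion of graphs is enough, since the lengths agree and each position carries one value.
graph⇒≋ : {π : Permutation′ n} {ρ : Permutation′ m} → n ≡ m →
          (∀ {i v} → Graph ρ i v → Graph π i v) → π ≋ ρ
graph⇒≋ {π = π} {ρ} eq h = eq , go
  where
  go : ∀ i j → toℕ i ≡ toℕ j → toℕ (π ⟨$⟩ʳ i) ≡ toℕ (ρ ⟨$⟩ʳ j)
  go i j e with h (graph-at ρ j)
  ... | graph a p w rewrite Fin.toℕ-injective (trans e (sym p)) = w

graph-no1324 : ∀ {π : Permutation′ n} {a b c d va vb vc vd} → Free π →
  Graph π a va → Graph π b vb → Graph π c vc → Graph π d vd →
  a < b → b < c → c < d → va < vc → vc < vb → vb < vd → ⊥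
graph-no1324 fr (graph _ refl refl) (graph _ refl refl) (graph _ refl refl) (graph _ refl refl) = no1324 fr

module _ (σ : Permutation′ m) (τ : Permutation′ n) where
  graph-⊕ˡ : ∀ {i v} → Graph σ i v → Graph (σ ⊕ τ) i v
  graph-⊕ˡ (graph a p w) = graph (a ↑ˡ n) (trans (Fin.toℕ-↑ˡ a n) p)
    (trans (cong toℕ (E.⊕-↑ˡ σ τ a)) (trans (Fin.toℕ-↑ˡ _ n) w))

  graph-⊕ʳ : ∀ {i v} → Graph τ i v → Graph (σ ⊕ τ) (m + i) (m + v)
  graph-⊕ʳ (graph a p w) = graph (m ↑ʳ a) (trans (Fin.toℕ-↑ʳ m a) (cong (m +_) p))
    (trans (cong toℕ (E.⊕-↑ʳ σ τ a)) (trans (Fin.toℕ-↑ʳ m _) (cong (m +_) w)))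

  data SumGraph : ℕ → ℕ → Set where
    inˡ : ∀ {i v} → i < m → v < m → Graph σ i v → SumGraph i v
    inʳ : ∀ {i v} → Graph τ i v → SumGraph (m + i) (m + v)

  sumGraph : ∀ {i v} → Graph (σ ⊕ τ) i v → SumGraph i v
  sumGraph (graph a refl refl) with E.sumView m a
  ... | E.left i rewrite E.⊕-↑ˡ σ τ i | Fin.toℕ-↑ˡ i n | Fin.toℕ-↑ˡ (σ ⟨$⟩ʳ i) n =
    inˡ (Fin.toℕ<n i) (Fin.toℕ<n _) (graph-at σ i)
  ... | E.right j rewrite E.⊕-↑ʳ σ τ j | Fin.toℕ-↑ʳ m j | Fin.toℕ-↑ʳ m (τ ⟨$⟩ʳ j) =
    inʳ (graph-at τ j)

  closed-⊕ʳ : E.Closed k τ → E.Closed (m + k) (σ ⊕ τ)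
  closed-⊕ʳ {k} c a with E.sumView m a
  ... | E.left i rewrite E.⊕-↑ˡ σ τ i | Fin.toℕ-↑ˡ i n | Fin.toℕ-↑ˡ (σ ⟨$⟩ʳ i) n =
    (λ _ → ℕ.<-≤-trans (Fin.toℕ<n _) (ℕ.m≤m+n m k)) , (λ _ → ℕ.<-≤-trans (Fin.toℕ<n i) (ℕ.m≤m+n m k))
  ... | E.right j rewrite E.⊕-↑ʳ σ τ j | Fin.toℕ-↑ʳ m j | Fin.toℕ-↑ʳ m (τ ⟨$⟩ʳ j) =
    (λ lt → ℕ.+-monoʳ-< m (proj₁ (c j) (ℕ.+-cancelˡ-< m _ _ lt))) ,
    (λ lt → ℕ.+-monoʳ-< m (proj₂ (c j) (ℕ.+-cancelˡ-< m _ _ lt)))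

  closed-⊕ʳ⁻¹ : E.Closed (m + k) (σ ⊕ τ) → E.Closed k τ
  closed-⊕ʳ⁻¹ {k} c j with c (m ↑ʳ j)
  ... | f , g rewrite E.⊕-↑ʳ σ τ j | Fin.toℕ-↑ʳ m j | Fin.toℕ-↑ʳ m (τ ⟨$⟩ʳ j) =
    (λ lt → ℕ.+-cancelˡ-< m _ _ (f (ℕ.+-monoʳ-< m lt))) ,
    (λ lt → ℕ.+-cancelˡ-< m _ _ (g (ℕ.+-monoʳ-< m lt)))

graph-point : ∀ {P V : Fin (suc n)} {π ρ} → Inserted P V π ρ → Graph ρ (toℕ P) (toℕ V)
graph-point {P = P} I = graph P refl (cong toℕ (point I))

graph-rest : ∀ {P V : Fin (suc n)} {π ρ} → Inserted P V π ρ → ∀ {i v} →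
             Graph π i v → Graph ρ (up (toℕ P) i) (up (toℕ V) v)
graph-rest {P = P} {V} I (graph a refl refl) = graph (punchIn P a) (toℕ-punchIn P a)
  (trans (cong toℕ (rest I a)) (toℕ-punchIn V _))

-- Here σ ends at the first cut and τ begins at the last one, so a cut inside either would
-- contradict `minimal` or `last`. An entry of τ would extend a 132 in σ to a 1324, and an entry of
-- σ would do so for a 213 in τ. Between the two cuts π is the identity, so the place k of the new
-- point does not affect the sum.
module _ (a m b : ℕ) (σ : Permutation′ (suc a)) (μ : Permutation′ m) (τ : Permutation′ (suc b))
         (π : Permutation′ (suc a + (m + suc b))) (ρ : Permutation′ (suc (suc a + (m + suc b))))
         (sum-≅ : σ ⊕ (μ ⊕ τ) ≅ π)
         (minimal : ∀ {b} → b < a → ¬ E.Closed (suc b) π)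
         (last : LastCut (suc a + m) π) (fr : Free π)
         (k : Fin (suc (suc a + (m + suc b)))) (A≤k : suc a ≤ toℕ k) (k≤B : toℕ k ≤ suc a + m)
         (I : Inserted k k π ρ) where
  private
    cA : E.Closed (suc a) π
    cA = closed-≅ sum-≅ (E.closed-⊕ σ (μ ⊕ τ) ℕ.≤-refl (E.closed-top σ))
    onσ : ∀ {i v} → Graph σ i v → Graph π i v
    onσ g = graph-≅ sum-≅ (graph-⊕ˡ σ (μ ⊕ τ) g)
    onτ : ∀ {i v} → Graph τ i v → Graph π (suc a + (m + i)) (suc a + (m + v))
    onτ g = graph-≅ sum-≅ (graph-⊕ʳ σ (μ ⊕ τ) (graph-⊕ʳ μ τ g))
    onMiddle : ∀ {j} → j < m → Graph π (suc a + j) (suc a + j)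
    onMiddle {j} j<m = graph i toℕ-i (trans (cong toℕ (fix
        (free⇒fixed {π = π} fr (cut z<s (ℕ.m<m+n (suc a) (ℕ.<-≤-trans z<s (ℕ.m≤n+m (suc b) m))) cA) (isCut last))
        (subst (suc a ≤_) (sym toℕ-i) (ℕ.m≤m+n _ _))
        (subst (_< suc a + m) (sym toℕ-i) (ℕ.+-monoʳ-< (suc a) j<m)))) toℕ-i)
      where
      i = fromℕ< (ℕ.+-monoʳ-< (suc a) (ℕ.<-≤-trans j<m (ℕ.m≤m+n m (suc b))))
      toℕ-i = Fin.toℕ-fromℕ< (ℕ.+-monoʳ-< (suc a) (ℕ.<-≤-trans j<m (ℕ.m≤m+n m (suc b))))

    σ-indecomposable : Indecomposable σ
    σ-indecomposable d with decomposable⇒cut {π = σ} d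
    ... | suc j , cut _ j<a c = minimal (ℕ.≤-pred j<a)
      (closed-≅ sum-≅ (E.closed-⊕ σ (μ ⊕ τ) (ℕ.<⇒≤ j<a) c))

    τ-indecomposable : Indecomposable τ
    τ-indecomposable d with decomposable⇒cut {π = τ} d
    ... | j , cut 0<j j<b c = ℕ.<⇒≱ (ℕ.+-monoʳ-< (suc a) (ℕ.m<m+n m 0<j)) (max last
      (cut z<s (ℕ.+-monoʳ-< (suc a) (ℕ.+-monoʳ-< m j<b))
        (closed-≅ sum-≅ (closed-⊕ʳ σ (μ ⊕ τ) (closed-⊕ʳ μ τ c)))))

    σ-avoids : Avoids σ p132
    σ-avoids (e , mono , iff) = graph-no1324 fr
      (onσ (graph-at σ (e 0F))) (onσ (graph-at σ (e 1F))) (onσ (graph-at σ (e 2F))) (onτ (graph-at τ zero))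
      (mono 0F 1F z<s) (mono 1F 2F (s<s z<s)) (ℕ.<-≤-trans (Fin.toℕ<n _) (ℕ.m≤m+n _ _))
      (Equivalence.from (iff 0F 2F) z<s) (Equivalence.from (iff 2F 1F) (s<s z<s))
      (ℕ.<-≤-trans (Fin.toℕ<n _) (ℕ.m≤m+n _ _))

    τ-avoids : Avoids τ p213
    τ-avoids (e , mono , iff) = graph-no1324 fr
      (onσ (graph-at σ zero)) (onτ (graph-at τ (e 0F))) (onτ (graph-at τ (e 1F))) (onτ (graph-at τ (e 2F)))
      (ℕ.<-≤-trans (Fin.toℕ<n _) (ℕ.m≤m+n (suc a) (m + toℕ (e 0F)))) (shift (mono 0F 1F z<s)) (shift
          (mono 1F 2F (s<s z<s)))
      (ℕ.<-≤-trans (Fin.toℕ<n _) (ℕ.m≤m+n _ _))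
      (shift (Equivalence.from (iff 1F 0F) z<s)) (shift (Equivalence.from (iff 0F 2F) (s<s z<s)))
      where
      shift : ∀ {x y} → x < y → suc a + (m + x) < suc a + (m + y)
      shift lt = ℕ.+-monoʳ-< (suc a) (ℕ.+-monoʳ-< m lt)

    π-sum : π ≋ σ ⊕ id {m} ⊕ τ
    π-sum = graph⇒≋ refl (λ g → go (sumGraph σ (id ⊕ τ) g))
      where
      go : ∀ {i v} → SumGraph σ (id {m} ⊕ τ) i v → Graph π i v
      go (inˡ _ _ g) = onσ g
      go (inʳ g) with sumGraph id τ g
      ... | inˡ j<m _ (graph _ refl refl) = onMiddle j<m
      ... | inʳ g′ = onτ g′

    ρ-sum : ρ ≋ σ ⊕ id {suc m} ⊕ τ
    ρ-sum = graph⇒≋ (sym (ℕ.+-suc (suc a) (m + suc b))) (λ g → go (sumGraph σ (id ⊕ τ) g))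
      where
      before : ∀ {i v} → i < toℕ k → v < toℕ k → Graph π i v → Graph ρ i v
      before i<k v<k g = subst₂ (Graph ρ) (up-lo i<k) (up-lo v<k) (graph-rest I g)
      after : ∀ {i v} → toℕ k ≤ i → toℕ k ≤ v → Graph π i v → Graph ρ (suc i) (suc v)
      after k≤i k≤v g = subst₂ (Graph ρ) (up-hi k≤i) (up-hi k≤v) (graph-rest I g)
      middle : ∀ j → j < suc m → Graph ρ (suc a + j) (suc a + j)
      -- The middle of ρ has one more point than that of π: points before k are unchanged, k is the
      -- new one, and those after k come from the preceding index.
      middle j j≤m with ℕ.<-cmp (suc a + j) (toℕ k)
      ... | tri< lt _ _ = before lt lt (onMiddle (ℕ.+-cancelˡ-< (suc a) _ _ (ℕ.<-≤-trans lt k≤B)))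
      ... | tri≈ _ eq _ = subst (λ x → Graph ρ x x) (sym eq) (graph-point I)
      middle zero j≤m | tri> _ _ gt = contradiction (ℕ.≤-trans gt (ℕ.≤-reflexive (ℕ.+-identityʳ _))) (ℕ.≤⇒≯ A≤k)
      middle (suc j) j≤m | tri> _ _ gt = subst (λ x → Graph ρ x x) (sym (ℕ.+-suc (suc a) j))
        (after k≤ k≤ (onMiddle (ℕ.≤-pred j≤m)))
        where
        k≤ : toℕ k ≤ suc a + j
        k≤ = ℕ.≤-pred (subst (toℕ k <_) (ℕ.+-suc (suc a) j) gt)
      go : ∀ {i v} → SumGraph σ (id {suc m} ⊕ τ) i v → Graph ρ i v
      go (inˡ i<A v<A g) = before (ℕ.<-≤-trans i<A A≤k) (ℕ.<-≤-trans v<A A≤k) (onσ g)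
      go (inʳ g) with sumGraph id τ g
      ... | inˡ j<m _ (graph j refl refl) = middle (toℕ j) j<m
      ... | inʳ {i} {v} g′ = subst₂ (Graph ρ) (sym (ℕ.+-suc (suc a) (m + i))) (sym (ℕ.+-suc (suc a) (m + v)))
        (after (far i) (far v) (onτ g′))
        where
        far : ∀ i → toℕ k ≤ suc a + (m + i)
        far i = ℕ.≤-trans k≤B (ℕ.+-monoʳ-≤ (suc a) (ℕ.m≤m+n m i))

  sum-↦̃ : π ↦̃ ρ
  sum-↦̃ = f̃-sum m σ τ σ-indecomposable σ-avoids τ-indecomposable τ-avoids π-sum ρ-sum

grows⇒↦̃ : {π : Permutation′ n} {ρ : Permutation′ (suc n)} → Grows π ρ → π ↦̃ ρ
grows⇒↦̃ {zero} (grows _ _ (cut _ () _) _)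
grows⇒↦̃ {suc n} {π} {ρ} (grows k I c fr) with E.shortestPrefix π | lastCut? π
... | _ | inj₂ none = contradiction c none
... | a , a≤n , cA , minimal | inj₁ (K , l) =
  resize (K ∸ suc a) (n ∸ K) π ρ cA minimal
    (trans (sym (ℕ.+-assoc (suc a) (K ∸ suc a) (suc (n ∸ K)))) (trans (cong (_+ suc (n ∸ K)) A+m≡K)
      (trans (ℕ.+-suc K (n ∸ K)) (cong suc (ℕ.m+[n∸m]≡n (ℕ.≤-pred (bound (isCut l))))))))
    A+m≡K l fr k A≤k k≤K I
  where
  A≤k : suc a ≤ toℕ k
  A≤k = past (toℕ k) c
    where
    past : ∀ j → Cut j π → suc a ≤ j
    past (suc j) c = s≤s (ℕ.≮⇒≥ λ j<a → minimal j<a (closed c))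
  k≤K : toℕ k ≤ K
  k≤K = max l c
  A+m≡K : suc a + (K ∸ suc a) ≡ K
  A+m≡K = ℕ.m+[n∸m]≡n (ℕ.≤-trans A≤k k≤K)
  -- The length and the last cut are generalised to N and K, so that matching on `refl` presents π
  -- on a sum of three lengths.
  resize : ∀ m b {a N K} (π : Permutation′ N) (ρ : Permutation′ (suc N)) →
           E.Closed (suc a) π → (∀ {b} → b < a → ¬ E.Closed (suc b) π) →
           suc a + (m + suc b) ≡ N → suc a + m ≡ K →
           LastCut K π → Free π → ∀ k → suc a ≤ toℕ k → toℕ k ≤ K → Inserted k k π ρ → π ↦̃ ρ
  resize m b {a} π ρ cA minimal refl refl l = sum-↦̃ a m b σ μ τ π ρ sum-≅ minimal l
    where
    outer = E.Split.split (suc a) π cA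
    σ = proj₁ outer
    τ′ = proj₁ (proj₂ outer)
    outer-≅ : π ≅ σ ⊕ τ′
    outer-≅ = pointwise (proj₂ (proj₂ outer))
    inner = E.Split.split m τ′ (closed-⊕ʳ⁻¹ σ τ′ (closed-≅ outer-≅ (closed (isCut l))))
    μ = proj₁ inner
    τ = proj₁ (proj₂ inner)
    inner-≅ : τ′ ≅ μ ⊕ τ
    inner-≅ = pointwise (proj₂ (proj₂ inner))
    sum-≅ : σ ⊕ (μ ⊕ τ) ≅ π
    sum-≅ = ≅-sym (outer-≅ ∙ pointwise (E.≋⇒≈ {π = σ ⊕ τ′} {σ ⊕ (μ ⊕ τ)}
      (E.⊕-congʳ σ {τ′} {μ ⊕ τ} (E.≈⇒≋ {π = τ′} {μ ⊕ τ} (at inner-≅)))))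

-- Number of components

closed-sum : {π : Permutation′ n} (σ : Permutation′ m) (τ : Permutation′ k) → π ≋ σ ⊕ τ → E.Closed m π
closed-sum {π = π} σ τ (refl , h) = closed-≅ {π = σ ⊕ τ} {π}
  (≅-sym (pointwise (E.≋⇒≈ {π = π} {σ ⊕ τ} (refl , h)))) (E.closed-⊕ σ τ ℕ.≤-refl (E.closed-top σ))

TwoCuts : Permutation′ n → Set
TwoCuts π = ∃[ j ] ∃[ k ] j < k × Cut j π × Cut k π

comp≥2⇒cut : {π : Permutation′ n} → comp π ≥ 2 → ∃[ k ] Cut k π
comp≥2⇒cut {π = π} = go (components π) (Decomposition.sum (decompose π))
  where
  go : ∀ cs → π ≋ ⨁ cs → length cs ≥ 2 → ∃[ k ] Cut k π
  go (_ ∷ []) _ (s≤s ())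
  go ((a , σ) ∷ (b , τ) ∷ cs) h _ = suc a ,
    cut z<s (subst (suc a <_) (sym (proj₁ h)) (ℕ.m<m+n (suc a) {suc b + totalLength cs} z<s))
        (closed-sum {π = π} σ (τ ⊕ ⨁ cs) h)

comp≥3⇒twoCuts : {π : Permutation′ n} → comp π ≥ 3 → TwoCuts π
comp≥3⇒twoCuts {π = π} = go (components π) (Decomposition.sum (decompose π))
  where
  go : ∀ cs → π ≋ ⨁ cs → length cs ≥ 3 → TwoCuts π
  go (_ ∷ []) _ (s≤s ())
  go (_ ∷ _ ∷ []) _ (s≤s (s≤s ()))
  go ((a , σ) ∷ (b , τ) ∷ (c , υ) ∷ cs) (refl , h) _ = suc a , suc a + suc b , ℕ.m<m+n (suc a) {suc b} z<s ,
    cut z<s (ℕ.m<m+n (suc a) {suc b + (suc c + totalLength cs)} z<s) (closed-sum {π = π} σ (τ ⊕ υ ⊕ ⨁ cs)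
        (refl , h)) ,
    cut z<s (ℕ.+-monoʳ-< (suc a) (ℕ.m<m+n (suc b) {suc c + totalLength cs} z<s))
        (closed-≅ {π = σ ⊕ τ ⊕ υ ⊕ ⨁ cs} {π}
      (≅-sym (pointwise (E.≋⇒≈ {π = π} {σ ⊕ τ ⊕ υ ⊕ ⨁ cs} (refl , h))))
      (closed-⊕ʳ σ (τ ⊕ υ ⊕ ⨁ cs) (E.closed-⊕ τ (υ ⊕ ⨁ cs) ℕ.≤-refl (E.closed-top τ))))

cut⇒comp≥2 : {π : Permutation′ n} → Cut k π → comp π ≥ 2
cut⇒comp≥2 {k = k} {π} c = go (components π) (Decomposition.indecomposable (decompose π))
    (Decomposition.sum (decompose π))
  where
  go : ∀ cs → All (λ c → Indecomposable (proj₂ c)) cs → π ≋ ⨁ cs → length cs ≥ 2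
  go [] _ (refl , _) = contradiction (bound c) λ ()
  go ((a , σ) ∷ []) (indec ∷ []) h = ⊥-elim (indec (cut⇒decomposable {k = k} {σ} (shrink h c)))
    where
    -- A one-part sum ends in the empty permutation, which has to be stripped off.
    shrink : ∀ {n} {π : Permutation′ n} → π ≋ σ ⊕ id {0} → Cut k π → Cut k σ
    shrink {π = π} (refl , h) (cut p b c) = cut p b′ (λ i → down (c (i ↑ˡ 0)))
      where
      b′ : k < suc a
      b′ = subst (k <_) (ℕ.+-identityʳ (suc a)) b
      down : ∀ {i} → (toℕ (i ↑ˡ 0) < k → toℕ (π ⟨$⟩ʳ (i ↑ˡ 0)) < k) × (toℕ (π ⟨$⟩ʳ (i ↑ˡ 0)) < k → toℕ
          (i ↑ˡ 0) < k) →
             (toℕ i < k → toℕ (σ ⟨$⟩ʳ i) < k) × (toℕ (σ ⟨$⟩ʳ i) < k → toℕ i < k)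
      down {i} x rewrite h (i ↑ˡ 0) (i ↑ˡ 0) refl | E.⊕-↑ˡ σ (id {0}) i
        | Fin.toℕ-↑ˡ i 0 | Fin.toℕ-↑ˡ (σ ⟨$⟩ʳ i) 0 = x
  go (_ ∷ _ ∷ _) _ _ = s≤s (s≤s z≤n)

comp≥1 : (π : Permutation′ (suc n)) → comp π ≥ 1
comp≥1 π = go (components π) (Decomposition.sum (decompose π))
  where
  go : ∀ cs → π ≋ ⨁ cs → length cs ≥ 1
  go [] (() , _)
  go (_ ∷ _) _ = s≤s z≤n

-- The length of the first component can be read off its largest entry, which is the first entry of
-- q.
beginsWithLargest⇒cut : {q : Permutation′ (suc n)} → comp q ≡ 2 →
  Any BeginsWithLargest (head (components q)) → Cut (suc (toℕ (first q))) q
beginsWithLargest⇒cut {q = q} = go (components q) (Decomposition.sum (decompose q))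
  where
  go : ∀ cs → q ≋ ⨁ cs → length cs ≡ 2 → Any BeginsWithLargest (head cs) → Cut (suc (toℕ (first q))) q
  go ((a , σ) ∷ (b , τ) ∷ cs) h _ (just largest) rewrite trans (proj₂ h zero zero refl)
      (trans (cong toℕ (E.⊕-↑ˡ σ (τ ⊕ ⨁ cs) zero)) (trans (Fin.toℕ-↑ˡ (first σ) _)
        (trans (cong toℕ largest) (Fin.toℕ-fromℕ a)))) =
    cut z<s (subst (suc a <_) (sym (proj₁ h)) (ℕ.m<m+n (suc a) {suc b + totalLength cs} z<s))
        (closed-sum {π = q} σ (τ ⊕ ⨁ cs) h)

-- Transport of the definitions along ≅, inversion and reverse-complement

decomposable-≅ : {π ρ : Permutation′ n} → π ≅ ρ → Decomposable π → Decomposable ρ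
decomposable-≅ {π = π} h d = cut⇒decomposable (cut-≅ h (proj₂ (decomposable⇒cut {π = π} d)))

indecomposable-≅ : {π ρ : Permutation′ n} → π ≅ ρ → Indecomposable π → Indecomposable ρ
indecomposable-≅ h indec d = indec (decomposable-≅ (≅-sym h) d)

decomposable-flip : {π : Permutation′ n} → Decomposable π → Decomposable (flip π)
decomposable-flip {π = π} d = cut⇒decomposable (cut-flip (proj₂ (decomposable⇒cut {π = π} d)))

indecomposable-flip : {π : Permutation′ n} → Indecomposable π → Indecomposable (flip π)
indecomposable-flip {π = π} indec d = indec (decomposable-flip {π = flip π} d)

decomposable-ʳᶜ : {π : Permutation′ n} → Decomposable π → Decomposable (π ʳᶜ)
decomposable-ʳᶜ {π = π} d = cut⇒decomposable (cut-ʳᶜ (proj₂ (decomposable⇒cut {π = π} d)))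

indecomposable-ʳᶜ : {π : Permutation′ n} → Indecomposable π → Indecomposable (π ʳᶜ)
indecomposable-ʳᶜ {π = π} indec d =
  indec (decomposable-≅ (ʳᶜ-involutive π) (decomposable-ʳᶜ {π = π ʳᶜ} d))

avoids1324-≅ : {π ρ : Permutation′ n} → π ≅ ρ → Avoids π p1324 → Avoids ρ p1324
avoids1324-≅ {π = π} {ρ} h av =
  free⇒avoids (free-contained {π = π} {ρ} (contains-≅ h) (avoids⇒free av))

∖-≅ : {π ρ : Permutation′ (suc n)} {e e′ : Fin (suc n)} → π ≅ ρ → e ≡ e′ → π ∖ e ≅ ρ ∖ e′
∖-≅ {π = π} {e = e} h refl = ≅-sym (∖-inserted (inserted-≅ ≅-refl h (inserted-∖ π e)))

∖-flip : (π : Permutation′ (suc n)) (e : Fin (suc n)) → flip (π ∖ e) ≅ flip π ∖ (π ⟨$⟩ˡ e)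
∖-flip π e = ≅-sym (∖-inserted (inserted-flip (inserted-∖ π e)))

-- Almost decomposable permutations in terms of the deleted point, which makes the symmetries evident.
record Almost (π : Permutation′ (suc n)) : Set where
  constructor almost
  field
    indec    : Indecomposable π
    {P V}    : Fin (suc n)
    {base}   : Permutation′ n
    atBase   : Inserted P V base π
    extremal : P ≡ zero ⊎ V ≡ zero ⊎ P ≡ fromℕ n ⊎ V ≡ fromℕ n
    {size}   : ℕ
    cutBase  : Cut size base

almost⇒ : {π : Permutation′ (suc n)} → Almost π → AlmostDecomposable π
almost⇒ {π = π} (almost indec {P} {V} I ext c) = indec , V , which ext ,
  decomposable-≅ (≅-sym (∖-inserted I)) (cut⇒decomposable c)
  where
  which : P ≡ zero ⊎ V ≡ zero ⊎ P ≡ fromℕ _ ⊎ V ≡ fromℕ _ →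
          V ≡ zero ⊎ V ≡ first π ⊎ V ≡ fromℕ _ ⊎ V ≡ last π
  which (inj₁ refl)               = inj₂ (inj₁ (sym (point I)))
  which (inj₂ (inj₁ eq))          = inj₁ eq
  which (inj₂ (inj₂ (inj₁ refl))) = inj₂ (inj₂ (inj₂ (sym (point I))))
  which (inj₂ (inj₂ (inj₂ eq)))   = inj₂ (inj₂ (inj₁ eq))

⇒almost : {π : Permutation′ (suc n)} → AlmostDecomposable π → Almost π
⇒almost {π = π} (indec , e , which , d) = almost indec (inserted-∖ π e) (ext which)
  (proj₂ (decomposable⇒cut {π = π ∖ e} d))
  where
  ext : e ≡ zero ⊎ e ≡ first π ⊎ e ≡ fromℕ _ ⊎ e ≡ last π →
        π ⟨$⟩ˡ e ≡ zero ⊎ e ≡ zero ⊎ π ⟨$⟩ˡ e ≡ fromℕ _ ⊎ e ≡ fromℕ _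
  ext (inj₁ eq)                 = inj₂ (inj₁ eq)
  ext (inj₂ (inj₁ refl))        = inj₁ (inverseˡ π)
  ext (inj₂ (inj₂ (inj₁ eq)))   = inj₂ (inj₂ (inj₂ eq))
  ext (inj₂ (inj₂ (inj₂ refl))) = inj₂ (inj₂ (inj₁ (inverseˡ π)))

almost-≅ : {π ρ : Permutation′ (suc n)} → π ≅ ρ → Almost π → Almost ρ
almost-≅ h (almost indec I ext c) =
  almost (indecomposable-≅ h indec) (inserted-≅ ≅-refl h I) ext c

almost-flip : {π : Permutation′ (suc n)} → Almost π → Almost (flip π)
almost-flip {π = π} (almost indec I ext c) = almost (indecomposable-flip {π = π} indec) (inserted-flip I)
  (exchange ext) (cut-flip c)
  where
  exchange : ∀ {A B C D : Set} → A ⊎ B ⊎ C ⊎ D → B ⊎ A ⊎ D ⊎ C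
  exchange (inj₁ a)               = inj₂ (inj₁ a)
  exchange (inj₂ (inj₁ b))        = inj₁ b
  exchange (inj₂ (inj₂ (inj₁ c))) = inj₂ (inj₂ (inj₂ c))
  exchange (inj₂ (inj₂ (inj₂ d))) = inj₂ (inj₂ (inj₁ d))

almost-ʳᶜ : {π : Permutation′ (suc n)} → Almost π → Almost (π ʳᶜ)
almost-ʳᶜ {π = π} (almost indec I ext c) = almost (indecomposable-ʳᶜ {π = π} indec) (inserted-ʳᶜ I)
  (exchange ext) (cut-ʳᶜ c)
  where
  low : ∀ {n} {i : Fin (suc n)} → i ≡ fromℕ n → opposite i ≡ zero
  low {n} refl = opposite-zero _ (Fin.toℕ-fromℕ n)
  exchange : ∀ {n} {P V : Fin (suc n)} → P ≡ zero ⊎ V ≡ zero ⊎ P ≡ fromℕ n ⊎ V ≡ fromℕ n →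
             opposite P ≡ zero ⊎ opposite V ≡ zero ⊎ opposite P ≡ fromℕ n ⊎ opposite V ≡ fromℕ n
  exchange (inj₁ refl)               = inj₂ (inj₂ (inj₁ refl))
  exchange (inj₂ (inj₁ refl))        = inj₂ (inj₂ (inj₂ refl))
  exchange (inj₂ (inj₂ (inj₁ eq)))   = inj₁ (low eq)
  exchange (inj₂ (inj₂ (inj₂ eq)))   = inj₂ (inj₁ (low eq))

↦̃-≅ : {π π′ : Permutation′ n} {ρ ρ′ : Permutation′ (suc n)} → π ≅ π′ → ρ ≅ ρ′ → π ↦̃ ρ → π′ ↦̃ ρ′
↦̃-≅ {π = π} {π′} {ρ} {ρ′} h g (f̃-sum m σ τ iσ aσ iτ aτ eπ eρ) = f̃-sum m σ τ iσ aσ iτ aτ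
  (E.≋-transˡ {π = π′} {π} {σ ⊕ id {m} ⊕ τ} (at (≅-sym h)) eπ)
  (E.≋-transˡ {π = ρ′} {ρ} {σ ⊕ id {suc m} ⊕ τ} (at (≅-sym g)) eρ)

≋-flip : (π : Permutation′ n) (ρ : Permutation′ m) → π ≋ ρ → flip π ≋ flip ρ
≋-flip π ρ (refl , h) = E.≈⇒≋ {π = flip π} {flip ρ}
  (at (flip-cong {π = π} {ρ} (pointwise (E.≋⇒≈ {π = π} {ρ} (refl , h)))))

avoids-flip : (σ : Permutation′ n) (p : Permutation′ k) → flip p ≅ p → Avoids σ p → Avoids (flip σ) p
avoids-flip σ p sym-p av c = av (contains-trans σ (flip p) p (contains-flip (flip σ) p c) (contains-≅ sym-p))

↦̃-flip : {π : Permutation′ n} {ρ : Permutation′ (suc n)} → π ↦̃ ρ → flip π ↦̃ flip ρ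
↦̃-flip {π = π} {ρ} (f̃-sum m σ τ iσ aσ iτ aτ eπ eρ) = f̃-sum m (flip σ) (flip τ)
  (indecomposable-flip {π = σ} iσ)
  (avoids-flip σ p132 (pointwise λ { 0F → refl ; 1F → refl ; 2F → refl }) aσ)
  (indecomposable-flip {π = τ} iτ)
  (avoids-flip τ p213 (pointwise λ { 0F → refl ; 1F → refl ; 2F → refl }) aτ)
  (≋-flip π (σ ⊕ id {m} ⊕ τ) eπ) (≋-flip ρ (σ ⊕ id {suc m} ⊕ τ) eρ)

↦-≅ : {π π′ : Permutation′ (suc n)} {ρ ρ′ : Permutation′ (suc (suc n))} → π ≅ π′ → ρ ≅ ρ′ → π ↦ ρ → π′ ↦ ρ′
↦-≅ {π = π} h g (f-decomposable av d t) =
  f-decomposable (avoids1324-≅ h av) (decomposable-≅ h d) (↦̃-≅ h g t)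
↦-≅ {π = π} {π′} {ρ} {ρ′} h g (f-case₁ av ad d eq t) = f-case₁ (avoids1324-≅ h av)
  (almost⇒ (almost-≅ h (⇒almost {π = π} ad)))
  (decomposable-≅ (∖-≅ h (at h zero)) d)
  (trans (sym (at g zero)) (trans eq (cong inject₁ (at h zero))))
  (↦̃-≅ (∖-≅ h (at h zero)) (∖-≅ g (at g zero)) t)
↦-≅ {π = π} h g (f-case₂ av ad d t) = f-case₂ (avoids1324-≅ h av)
  (almost⇒ (almost-≅ h (⇒almost {π = π} ad)))
  (decomposable-≅ (∖-≅ h refl) d) (↦-≅ (flip-cong h) (flip-cong g) t)
↦-≅ {π = π} h g (f-case₃ av ad i j t) = f-case₃ (avoids1324-≅ h av)
  (almost⇒ (almost-≅ h (⇒almost {π = π} ad)))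
  (indecomposable-≅ (∖-≅ h (at h zero)) i) (indecomposable-≅ (∖-≅ h refl) j)
  (↦-≅ (ʳᶜ-cong h) (ʳᶜ-cong g) t)

-- Inversion turns case (1) into case (2) with the given derivation as premise, and case (2) back
-- into its own premise. In case (3) the two indecomposability conditions change places.
↦-flip : {π : Permutation′ (suc n)} {ρ : Permutation′ (suc (suc n))} → π ↦ ρ → flip π ↦ flip ρ
↦-flip {π = π} (f-decomposable av d t) = f-decomposable (free⇒avoids (free-flip (avoids⇒free {π = π} av)))
  (decomposable-flip {π = π} d) (↦̃-flip t)
↦-flip {π = π} t@(f-case₁ av ad d eq _) = f-case₂ (free⇒avoids (free-flip (avoids⇒free {π = π} av)))
  (almost⇒ (almost-flip (⇒almost {π = π} ad)))
  (decomposable-≅ (∖-flip π (first π) ∙ ∖-≅ (≅-refl {π = flip π}) (inverseˡ π))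
      (decomposable-flip {π = π ∖ first π} d)) t
↦-flip (f-case₂ _ _ _ t) = t
↦-flip {π = π} {ρ} (f-case₃ av ad i j t) = f-case₃ (free⇒avoids (free-flip (avoids⇒free {π = π} av)))
  (almost⇒ (almost-flip (⇒almost {π = π} ad)))
  (indecomposable-≅ (∖-flip π zero) (indecomposable-flip {π = π ∖ zero} j))
  (indecomposable-≅ (∖-flip π (first π) ∙ ∖-≅ (≅-refl {π = flip π}) (inverseˡ π))
      (indecomposable-flip {π = π ∖ first π} i))
  (↦-≅ (flip-ʳᶜ π) (flip-ʳᶜ ρ) (↦-flip t))

-- Case (1) of f for a prepended first entry

↦-prepended : ∀ {π : Permutation′ (suc n)} {ρ : Permutation′ (suc
    (suc n))} {u u′ w w⁺} → Free π → Indecomposable π →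
              Inserted zero u w π → Inserted zero u′ w⁺ ρ → toℕ u′ ≡ toℕ u → Grows w w⁺ → π ↦ ρ
↦-prepended {π = π} {ρ} fr indec I J eq g = f-case₁ (free⇒avoids fr)
  (almost⇒ (almost indec I (inj₁ refl) (cutThere g)))
  (decomposable-≅ (≅-sym w≅) (cut⇒decomposable (cutThere g)))
  (trans (point J) (Fin.toℕ-injective (trans eq (sym (trans (Fin.toℕ-inject₁ _) (cong toℕ (point I)))))))
  (grows⇒↦̃ (grows-≅ (≅-sym w≅) (≅-sym w⁺≅) g))
  where
  w≅ = ∖-≅ (≅-refl {π = π}) (point I) ∙ ∖-inserted I
  w⁺≅ = ∖-≅ (≅-refl {π = ρ}) (point J) ∙ ∖-inserted J

swap-below : ∀ {a b a′ b′} → a ≤ b′ → b ≡ suc b′ → a′ ≡ a → Swap a b a′ b′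
swap-below a≤b refl refl = below a≤b

swap-above : ∀ {a b a′ b′} → b ≤ a → a′ ≡ suc a → b′ ≡ b → Swap a b a′ b′
swap-above b≤a refl refl = above b≤a

inserted-same : ∀ {P V W : Fin (suc n)} {π π′ ρ} → Inserted P V π ρ → Inserted P W π′ ρ → V ≡ W × π ≅ π′
inserted-same I J with trans (sym (point I)) (point J)
... | refl = refl , inserted-base I J ≅-refl

-- A fixed point inserted next to another fixed point may as well be inserted on its other side.
slide : ∀ {B} d (x κ : Fin (suc n)) (π : Permutation′ n) → toℕ x ≡ d + toℕ κ →
        Fixed (toℕ κ) B π → toℕ x ≤ B → insertAt κ κ π ≅ insertAt x x π
slide zero x κ π eq _ _ rewrite Fin.toℕ-injective eq = ≅-refl
slide {n = suc n} (suc d) (suc x) κ π eq f x<B =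
  slide d (inject₁ x) κ π (trans (Fin.toℕ-inject₁ x) x≡) f
    (subst (_≤ _) (sym (Fin.toℕ-inject₁ x)) (ℕ.<⇒≤ x<B)) ∙
  inserted-unique (inserted-swap I (insertAt-inserted (inject₁ x) (inject₁ x) π) beyond beyond I)
    (insertAt-inserted (suc x) (suc x) π) ≅-refl
  where
  x≡ : toℕ x ≡ d + toℕ κ
  x≡ = ℕ.suc-injective eq
  I : Inserted x x (removeAt x π) π
  I = subst (λ v → Inserted x v (removeAt x π) π)
    (fix f (subst (toℕ κ ≤_) (sym x≡) (ℕ.m≤n+m (toℕ κ) d)) x<B) (removeAt-inserted x π)
  beyond : Swap (toℕ x) (toℕ (inject₁ x)) (suc (toℕ x)) (toℕ x)
  beyond = swap-above (ℕ.≤-reflexive (Fin.toℕ-inject₁ x)) refl (sym (Fin.toℕ-inject₁ x))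

-- A cut of the prepended permutation encloses its first entry x, so s has a cut at or beyond x.
-- Between κ and that cut s is the identity, so the new fixed point slides from κ to x. Prepending x
-- moves it to position and value x + 1, where the prepended permutation has a cut.
grows-below : ∀ {j} (s : Permutation′ n) (x κ : Fin (suc n)) → 0 < toℕ κ → toℕ κ ≤ toℕ x → E.Closed (toℕ κ) s →
  Cut j (insertAt zero x s) → Free (insertAt zero x s) →
  Grows (insertAt zero x s) (insertAt zero (inject₁ x) (insertAt κ κ s))
grows-below {n} {suc j} s x κ 0<κ κ≤x cκ c fr = grows-≅ ≅-refl
  (inserted-unique (insertAt-inserted zero (inject₁ x) (insertAt x x s))
    (insertAt-inserted zero (inject₁ x) (insertAt κ κ s))
    (≅-sym (slide (toℕ x ∸ toℕ κ) x κ s (sym (ℕ.m∸n+n≡m κ≤x)) f x≤j)))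
  (grows (suc x)
    (inserted-swap (insertAt-inserted x x s) (insertAt-inserted zero (inject₁ x) (insertAt x x s))
      (above z≤n) (swap-above (ℕ.≤-reflexive (Fin.toℕ-inject₁ x)) refl (sym (Fin.toℕ-inject₁ x))) W)
    (cut z<s (s<s (ℕ.≤-<-trans x≤j j<n)) (closed-inserted-below W z≤n ℕ.≤-refl (fixed-closed cκ f κ≤x x≤j)))
    fr)
  where
  W = insertAt-inserted zero x s
  j<n : j < n
  j<n = ℕ.≤-pred (bound c)
  x≤j : toℕ x ≤ j
  x≤j = ℕ.≤-pred (subst (λ i → toℕ i < suc j) (point (insertAt-inserted zero x s))
      (closed-< {π = insertAt zero x s} (closed c) (pos c)))
  f : Fixed (toℕ κ) j s
  f = free⇒fixed (free-contained {π = insertAt zero x s} (contains-inserted W) fr)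
    (cut 0<κ (ℕ.≤-<-trans (ℕ.≤-trans κ≤x x≤j) j<n) cκ)
    (cut (ℕ.<-≤-trans 0<κ (ℕ.≤-trans κ≤x x≤j)) j<n (closed-inserted-below⁻¹ W z≤n x≤j (closed c)))

-- Raising the first entry

module Prepend {M K : ℕ} (r : Permutation′ (suc M)) (fr : Free r) (lc : LastCut K r)
               (y : Fin (suc M)) (K≤y : K ≤ toℕ y) where

  -- The place K is needed in two types: `κ` for insertion into r, and `κ₀` for insertion into r
  -- with one point deleted.
  κ₀ : Fin (suc M)
  κ₀ = fromℕ< (bound (isCut lc))

  toℕ-κ₀ : toℕ κ₀ ≡ K
  toℕ-κ₀ = Fin.toℕ-fromℕ< (bound (isCut lc))

  κ : Fin (suc (suc M))
  κ = inject₁ κ₀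

  toℕ-κ : toℕ κ ≡ K
  toℕ-κ = trans (Fin.toℕ-inject₁ κ₀) toℕ-κ₀

  π q̂ r⁺ : Permutation′ (suc (suc M))
  π  = insertAt zero (suc y) r
  q̂  = insertAt zero (inject₁ y) r
  r⁺ = insertAt κ κ r

  ρ : Permutation′ (suc (suc (suc M)))
  ρ = insertAt zero (suc (inject₁ y)) r⁺

  private
    π-inserted : Inserted zero (suc y) r π
    π-inserted = insertAt-inserted _ _ _
    q̂-inserted : Inserted zero (inject₁ y) r q̂
    q̂-inserted = insertAt-inserted _ _ _
    ρ-inserted : Inserted zero (suc (inject₁ y)) r⁺ ρ
    ρ-inserted = insertAt-inserted _ _ _

  r-grows : Grows r r⁺
  r-grows = grows κ (insertAt-inserted κ κ r) (subst (λ x → Cut x r) (sym toℕ-κ) (isCut lc)) fr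

  -- A cut of π encloses the first entry y + 1. Without that entry it becomes a cut of r beyond y,
  -- hence beyond the last cut K.
  π-indecomposable : Indecomposable π
  π-indecomposable d with decomposable⇒cut {π = π} d
  ... | suc j , cut _ j<M c = ℕ.<⇒≱ y<j (ℕ.≤-trans (max lc
      (cut (ℕ.≤-<-trans z≤n y<j) (ℕ.≤-pred j<M) (closed-inserted-below⁻¹ π-inserted z≤n y<j c))) K≤y)
    where
    y<j : toℕ y < j
    y<j = ℕ.≤-pred (subst (λ i → toℕ i < suc j) (point π-inserted) (closed-< {π = π} c z<s))

  π-free : Free π
  π-free = free λ {a} {b} {c} {d} → go a b c d
    where
    value : ∀ i → toℕ (π ⟨$⟩ʳ suc i) ≡ up (suc (toℕ y)) (toℕ (r ⟨$⟩ʳ i))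
    value i = trans (cong toℕ (rest π-inserted i)) (toℕ-punchIn (suc y) _)
    lower : ∀ {i j} → π ⟨$⟩ʳ suc i Fin.< π ⟨$⟩ʳ suc j → r ⟨$⟩ʳ i Fin.< r ⟨$⟩ʳ j
    lower {i} {j} lt = up-cancel-< (suc (toℕ y)) (subst₂ _<_ (value i) (value j) lt)
    go : ∀ a b c d → a Fin.< b → b Fin.< c → c Fin.< d →
         π ⟨$⟩ʳ a Fin.< π ⟨$⟩ʳ c → π ⟨$⟩ʳ c Fin.< π ⟨$⟩ʳ b → π ⟨$⟩ʳ b Fin.< π ⟨$⟩ʳ d → ⊥
    go (suc a) (suc b) (suc c) (suc d) (s<s ab) (s<s bc) (s<s cd) va vc vb =
      no1324 fr ab bc cd (lower va) (lower vc) (lower vb)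
    -- A 213 above the first entry of π lies past the cut K of r, so the first entry of r completes it to a 1324.
    go zero (suc b) (suc c) (suc d) _ (s<s bc) (s<s cd) va vc vb =
      no1324 fr {zero} {b} (ℕ.<-≤-trans (pos (isCut lc)) K≤b) bc cd
        (ℕ.<-≤-trans (closed-< {π = r} (closed (isCut lc)) (pos (isCut lc))) K≤rc) (lower vc) (lower vb)
      where
      y<rc : toℕ y < toℕ (r ⟨$⟩ʳ c)
      y<rc with ℕ.<-≤-connex (toℕ (r ⟨$⟩ʳ c)) (suc (toℕ y))
      ... | inj₂ le = le
      ... | inj₁ lt = contradiction lt (ℕ.<-asym
        (subst₂ _<_ (cong toℕ (point π-inserted)) (trans (value c) (up-lo lt)) va))
      K≤rc : K ≤ toℕ (r ⟨$⟩ʳ c)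
      K≤rc = ℕ.≤-trans K≤y (ℕ.<⇒≤ y<rc)
      K≤b : K ≤ toℕ b
      K≤b = ℕ.≮⇒≥ λ b<K → ℕ.<⇒≱ (closed-< {π = r} (closed (isCut lc)) b<K)
        (ℕ.≤-trans K≤rc (ℕ.<⇒≤ (lower vc)))

  π-almost : Almost π
  π-almost = almost π-indecomposable π-inserted (inj₁ refl) (isCut lc)

  π↦ρ : π ↦ ρ
  π↦ρ = ↦-prepended π-free π-indecomposable π-inserted ρ-inserted (cong suc (Fin.toℕ-inject₁ y)) r-grows

  -- The new fixed point of r⁺ has value K, which is below the first entry y + 1 of ρ, so deleting
  -- it lowers that entry to y.
  ρ-contains : Contains ρ q̂
  ρ-contains = contains-inserted {P = suc κ} {inject₁ κ} (inserted-swap (insertAt-inserted κ κ r) ρ-inserted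
    (above z≤n)
    (swap-below (subst₂ _≤_ (sym toℕ-κ) (sym (Fin.toℕ-inject₁ y)) K≤y) refl (Fin.toℕ-inject₁ κ)) q̂-inserted)

  -- Under reverse-complement f keeps the coordinates of the deleted point as counted from the far
  -- end. Counted from the near end, both its position and its value grow by one.
  record Extension (P : Fin (suc M)) : Set where
    constructor extension
    field
      {w⁺} : Permutation′ (suc (suc M))
      {ρ′} : Permutation′ (suc (suc (suc M)))
      grown     : Grows (removeAt (suc P) π) w⁺
      extended  : Inserted (suc (suc P)) (suc (π ⟨$⟩ʳ suc P)) w⁺ ρ′
      contained : Contains ρ′ q̂

  -- Deleting the point at the position P + 1 from π, growing the result, and putting the point back.
  extend : (P : Fin (suc M)) → K ≤ toℕ P → K ≤ toℕ (r ⟨$⟩ʳ P) → (r ⟨$⟩ʳ P ≡ y → toℕ P ≡ M) →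
           ∃[ j ] Cut j (removeAt (suc P) π) → Extension P
  extend P K≤P K≤V V≡y⇒last (j , c) = compare (Fin.<-cmp V y)
    where
    V = r ⟨$⟩ʳ P
    s = removeAt P r
    s-inserted : Inserted P V s r
    s-inserted = removeAt-inserted P r
    s-closed : E.Closed K s
    s-closed = closed-inserted-above⁻¹ s-inserted K≤P K≤V (closed (isCut lc))
    b-inserted : Inserted (suc P) (π ⟨$⟩ʳ suc P) (removeAt (suc P) π) π
    b-inserted = removeAt-inserted (suc P) π
    s⁺ = insertAt κ₀ κ₀ s
    s⁺-inserted : Inserted (suc P) (suc V) s⁺ r⁺
    s⁺-inserted = inserted-swap s-inserted (insertAt-inserted κ κ r)
      (swap-above (subst (_≤ toℕ P) (sym toℕ-κ) K≤P) refl (trans toℕ-κ₀ (sym toℕ-κ)))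
      (swap-above (subst (_≤ toℕ V) (sym toℕ-κ) K≤V) refl (trans toℕ-κ₀ (sym toℕ-κ)))
      (insertAt-inserted κ₀ κ₀ s)

    -- x is the first entry that π has after the deletion. In the two strict cases putting the point
    -- back yields ρ itself.
    moved : ∀ (x : Fin (suc M)) {V′} → K ≤ toℕ x → Inserted (suc P) V′ (insertAt zero x s) π →
            Inserted (suc (suc P)) (suc V′) (insertAt zero (inject₁ x) s⁺) ρ → Extension P
    moved x K≤x I J with inserted-same I b-inserted
    ... | refl , h = extension
      (grows-≅ h ≅-refl (grows-below s x κ₀ (subst (0 <_) (sym toℕ-κ₀) (pos (isCut lc)))
        (subst (_≤ toℕ x) (sym toℕ-κ₀) K≤x) (subst (λ k → E.Closed k s) (sym toℕ-κ₀) s-closed)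
        (cut-≅ (≅-sym h) c) (free-contained {π = π} (contains-inserted I) π-free)))
      J ρ-contains

    lower-inserted : toℕ V ≤ toℕ y → Inserted (suc P) (inject₁ V) (insertAt zero y s) π
    lower-inserted V≤y = inserted-swap s-inserted π-inserted (above z≤n)
      (swap-below V≤y refl (Fin.toℕ-inject₁ V)) (insertAt-inserted zero y s)

    compare : _ → Extension P
    compare (tri< V<y _ _) = moved y K≤y (lower-inserted (ℕ.<⇒≤ V<y))
      (inserted-swap s⁺-inserted ρ-inserted (above z≤n)
        (swap-below (subst (suc (toℕ V) ≤_) (sym (Fin.toℕ-inject₁ y)) V<y) refl (cong suc (Fin.toℕ-inject₁ V)))
        (insertAt-inserted zero (inject₁ y) s⁺))
    compare (tri> _ _ y<V) = moved x (subst (K ≤_) (sym toℕ-x) (ℕ.m≤n⇒m≤1+n K≤y))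
      (inserted-swap s-inserted π-inserted (above z≤n)
        (swap-above y<V refl toℕ-x) (insertAt-inserted zero x s))
      (inserted-swap s⁺-inserted ρ-inserted (above z≤n)
        (swap-above (s≤s (subst (_≤ toℕ V) (sym (Fin.toℕ-inject₁ y)) (ℕ.<⇒≤ y<V))) refl
          (trans (Fin.toℕ-inject₁ x) (trans toℕ-x (cong suc (sym (Fin.toℕ-inject₁ y))))))
        (insertAt-inserted zero (inject₁ x) s⁺))
      where
      sy<N : suc (toℕ y) < suc M
      sy<N = ℕ.≤-<-trans y<V (Fin.toℕ<n V)
      x : Fin (suc M)
      x = fromℕ< sy<N
      toℕ-x : toℕ x ≡ suc (toℕ y)
      toℕ-x = Fin.toℕ-fromℕ< sy<N
    -- Here the growth of the remainder does not lead to ρ, but to a different permutation containing q̂.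
    compare (tri≈ _ V≡y _) with inserted-same (lower-inserted (ℕ.≤-reflexive (cong toℕ V≡y))) b-inserted
    ... | V₀≡ , h = extension
      (grows ĵ (insertAt-inserted ĵ ĵ _) (subst (λ x → Cut x (removeAt (suc P) π)) (sym toℕ-ĵ) c)
        (free-contained {π = π} (contains-inserted b-inserted) π-free))
      (insertAt-inserted (suc (suc P)) (suc (π ⟨$⟩ʳ suc P)) _)
      -- The remainder begins with y: with the point put back at value y it is π, and at value y + 1
      -- it is q̂. In ρ′ the value is y + 1, so q̂ remains after the new fixed point is deleted.
      -- That point lies above y + 1 and, as P is the last position, before the point put back.
      (contains-inserted {P = inject₁ ĵ} {suc ĵ} (inserted-swap (insertAt-inserted ĵ ĵ _)
          (insertAt-inserted (suc (suc P)) (suc (π ⟨$⟩ʳ suc P)) _)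
        (swap-below (subst (_≤ suc (toℕ P)) (sym toℕ-ĵ)
          (subst (λ x → j ≤ suc x) (sym (V≡y⇒last V≡y)) (ℕ.<⇒≤ (bound c)))) refl (Fin.toℕ-inject₁ ĵ))
        (swap-above (subst₂ _≤_ (cong suc (sym toℕ-V₀)) (sym toℕ-ĵ) V<j) refl (cong suc (sym toℕ-V₀)))
        (inserted-≅ h ≅-refl (inserted-swap s-inserted q̂-inserted (above z≤n)
          (swap-above (subst (_≤ toℕ V) (sym (Fin.toℕ-inject₁ y)) (ℕ.≤-reflexive (cong toℕ (sym V≡y)))) refl
            (sym (Fin.toℕ-inject₁ y)))
          (insertAt-inserted zero y s)))))
      where
      toℕ-V₀ : toℕ (π ⟨$⟩ʳ suc P) ≡ toℕ V
      toℕ-V₀ = trans (cong toℕ (sym V₀≡)) (Fin.toℕ-inject₁ V)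
      ĵ : Fin (suc (suc M))
      ĵ = fromℕ< (ℕ.m<n⇒m<1+n (bound c))
      toℕ-ĵ : toℕ ĵ ≡ j
      toℕ-ĵ = Fin.toℕ-fromℕ< (ℕ.m<n⇒m<1+n (bound c))
      V<j : toℕ V < j
      V<j = subst (_< j) (trans (cong toℕ (point (insertAt-inserted zero y s))) (cong toℕ (sym V≡y)))
        (closed-< {π = insertAt zero y s} (closed (cut-≅ (≅-sym h) c)) (pos c))

  -- The bound makes the largest entry of π come from r instead of being the first entry. This is
  -- where the extra requirement on q₁ enters.
  module _ (y<M : toℕ y < M) where
    private
      bottom top : Fin (suc M)
      bottom = fromℕ M
      top    = r ⟨$⟩ˡ fromℕ M

      K≤M : K ≤ toℕ (fromℕ M)
      K≤M = subst (K ≤_) (sym (Fin.toℕ-fromℕ M)) (ℕ.≤-pred (bound (isCut lc)))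

      r-top : r ⟨$⟩ʳ top ≡ fromℕ M
      r-top = inverseʳ r

      π-top : toℕ (π ⟨$⟩ʳ suc top) ≡ suc M
      π-top = trans (cong toℕ (rest π-inserted top)) (trans (toℕ-punchIn (suc y) _)
        (trans (cong (up (suc (toℕ y))) (trans (cong toℕ r-top) (Fin.toℕ-fromℕ M))) (up-hi y<M)))

      at-bottom : ∀ {u v} {w : Permutation′ (suc M)} → Inserted (suc bottom) v w π → u ≡ opposite v →
                  Inserted zero u (w ʳᶜ) (π ʳᶜ)
      at-bottom {v = v} {w} I refl = subst (λ p → Inserted p (opposite v) (w ʳᶜ) (π ʳᶜ))
        (opposite-zero (suc bottom) (cong suc (Fin.toℕ-fromℕ M))) (inserted-ʳᶜ I)

      at-top : ∀ {w : Permutation′ (suc M)} → Inserted (suc top) (π ⟨$⟩ʳ suc top) w π →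
               Inserted (opposite (suc top)) zero (w ʳᶜ) (π ʳᶜ)
      at-top {w} I = subst (λ v → Inserted _ v (w ʳᶜ) (π ʳᶜ)) (opposite-zero _ π-top) (inserted-ʳᶜ I)

      ʳᶜ-free : Free (π ʳᶜ)
      ʳᶜ-free = free-ʳᶜ π-free
      ʳᶜ-indecomposable : Indecomposable (π ʳᶜ)
      ʳᶜ-indecomposable = indecomposable-ʳᶜ {π = π} π-indecomposable

    -- The first entry of the reverse-complement comes from the last position of π, and its entry 1
    -- from the largest entry of π. Deleting these two points from π therefore decides which case of
    -- f applies.
    ʳᶜ-image : ∃[ ρ′ ] (π ʳᶜ ↦ ρ′ ʳᶜ) × Contains ρ′ q̂
    ʳᶜ-image with decomposable? (removeAt (suc bottom) π)
    ... | yes d with extend bottom K≤M (closed-≥ {π = r} (closed (isCut lc)) K≤M) (λ _ → Fin.toℕ-fromℕ M)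
                       (decomposable⇒cut {π = removeAt (suc bottom) π} d)
    ...   | extension {w⁺} {ρ′} g I co = ρ′ ,
      ↦-prepended ʳᶜ-free ʳᶜ-indecomposable (at-bottom (removeAt-inserted (suc bottom) π) refl)
        (subst (λ p → Inserted p (opposite (suc (π ⟨$⟩ʳ suc bottom))) (w⁺ ʳᶜ) (ρ′ ʳᶜ))
          (opposite-zero (suc (suc bottom)) (cong (λ x → suc (suc x)) (Fin.toℕ-fromℕ M))) (inserted-ʳᶜ I))
        (Fin.toℕ-inject₁ _) (grows-ʳᶜ g) , co
    ʳᶜ-image | no ¬bottom with decomposable? (removeAt (suc top) π)
    ... | yes d with extend top
                       (closed-≥ {π = flip r} (closed (cut-flip (isCut lc))) K≤M)
                       (subst (λ v → K ≤ toℕ v) (sym r-top) K≤M)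
                       -- The largest entry of r exceeds y, so the exceptional case V = y does not
                       -- arise here.
                       (λ eq → contradiction (trans (cong toℕ (trans (sym eq) r-top)) (Fin.toℕ-fromℕ M))
                           (ℕ.<⇒≢ y<M))
                       (decomposable⇒cut {π = removeAt (suc top) π} d)
    ...   | extension {w⁺} {ρ′} g I co = ρ′ ,
      ↦-flip {π = flip (π ʳᶜ)} {flip (ρ′ ʳᶜ)} (↦-prepended (free-flip ʳᶜ-free)
          (indecomposable-flip {π = π ʳᶜ} ʳᶜ-indecomposable)
        (inserted-flip (at-top (removeAt-inserted (suc top) π)))
        (inserted-flip (subst (λ v → Inserted _ v (w⁺ ʳᶜ) (ρ′ ʳᶜ)) (opposite-zero _ (cong suc π-top))
            (inserted-ʳᶜ I)))
        (Fin.toℕ-inject₁ _) (grows-flip (grows-ʳᶜ g))) , co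
    ʳᶜ-image | no ¬bottom | no ¬top = ρ ,
      f-case₃ (free⇒avoids ʳᶜ-free) (almost⇒ (almost-ʳᶜ π-almost))
        (indecomposable-≅ (≅-sym (∖-≅ (≅-refl {π = π ʳᶜ}) (point B) ∙ ∖-inserted B))
            (indecomposable-ʳᶜ {π = removeAt (suc bottom) π} ¬bottom))
        (indecomposable-≅ (≅-sym (∖-inserted (at-top (removeAt-inserted (suc top) π))))
            (indecomposable-ʳᶜ {π = removeAt (suc top) π} ¬top))
        (↦-≅ (≅-sym (ʳᶜ-involutive π)) (≅-sym (ʳᶜ-involutive ρ)) π↦ρ) , ρ-contains
      where
      B = at-bottom (removeAt-inserted (suc bottom) π) refl

-- Witnesses of incompatibility

record Witness (p : Permutation′ k) : Set where
  constructor witness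
  field
    {size}   : ℕ
    π        : Permutation′ (suc size)
    ρ        : Permutation′ (suc (suc size))
    domain   : Decomposable π ⊎ AlmostDecomposable π
    π-free   : Free π
    avoided  : Avoids π p
    maps     : π ↦ ρ
    attained : Contains ρ p

witness⇒incompatible : {p : Permutation′ k} → Witness p → Incompatible p
witness⇒incompatible (witness π ρ domain fr av maps co) compatible =
  compatible π domain (free⇒avoids fr) av ρ maps co

witness-≅ : {p q : Permutation′ k} → p ≅ q → Witness p → Witness q
witness-≅ {p = p} {q} h (witness π ρ domain fr av maps co) = witness π ρ domain fr
  (λ c → av (contains-trans π q p c (contains-≅ (≅-sym h)))) maps (contains-trans ρ p q co (contains-≅ h))

witness-flip : {p : Permutation′ k} → Witness p → Witness (flip p)
witness-flip {p = p} (witness π ρ domain fr av maps co) = witness (flip π) (flip ρ) (go domain) (free-flip fr)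
  (λ c → av (contains-flip (flip π) (flip p) c)) (↦-flip maps) (contains-flip ρ p co)
  where
  go : Decomposable π ⊎ AlmostDecomposable π → Decomposable (flip π) ⊎ AlmostDecomposable (flip π)
  go (inj₁ d)  = inj₁ (decomposable-flip {π = π} d)
  go (inj₂ ad) = inj₂ (almost⇒ (almost-flip (⇒almost {π = π} ad)))

-- The entry right after the first cut is a fixed point that f̃ restores after its deletion. The
-- permutation left by the deletion is too short to contain q.
twoCuts⇒witness : {q : Permutation′ (suc n)} → Free q → TwoCuts q → Witness q
twoCuts⇒witness {zero} _ (_ , _ , _ , cut () (s≤s z≤n) _ , _)
twoCuts⇒witness {suc n} {q} fr (j , k , j<k , cj , ck) = witness π q
  (inj₁ (cut⇒decomposable (cutThere g))) (isFree g)
  (λ c → ℕ.1+n≰n (contains-length π q c))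
  (f-decomposable (free⇒avoids (isFree g)) (cut⇒decomposable (cutThere g)) (grows⇒↦̃ g))
  (contains-≅ (≅-refl {π = q}))
  where
  ĵ : Fin (suc (suc n))
  ĵ = fromℕ< (bound cj)
  toℕ-ĵ : toℕ ĵ ≡ j
  toℕ-ĵ = Fin.toℕ-fromℕ< (bound cj)
  π = removeAt ĵ q
  I : Inserted ĵ ĵ π q
  I = subst (λ v → Inserted ĵ v π q)
    (fix (free⇒fixed fr cj ck) (ℕ.≤-reflexive (sym toℕ-ĵ)) (subst (_< k) (sym toℕ-ĵ) j<k)) (removeAt-inserted ĵ q)
  g : Grows π q
  g = grows ĵ I
    -- The second cut ensures that entries remain beyond j after the deletion, so j is still a
    -- proper cut.
    (cut (subst (0 <_) (sym toℕ-ĵ) (pos cj)) (subst (_< suc n) (sym toℕ-ĵ) (ℕ.<-≤-trans j<k (ℕ.≤-pred (bound ck))))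
      (closed-inserted-above⁻¹ I ℕ.≤-refl ℕ.≤-refl (subst (λ x → E.Closed x q) (sym toℕ-ĵ) (closed cj))))
    (free-contained {π = q} (contains-inserted I) fr)

-- The permutation `q̂` built from r and y may be longer than q, which is why q is only required to
-- be contained in it. `below-top` carries the extra bound over from q to y.
record Prepended (q : Permutation′ (suc n)) : Set where
  constructor prepended
  field
    {M K}  : ℕ
    r      : Permutation′ (suc M)
    r-free : Free r
    lc     : LastCut K r
    y      : Fin (suc M)
    K≤y    : K ≤ toℕ y
  open Prepend r r-free lc y K≤y public
  field
    below-top : suc (toℕ (first q)) < n → toℕ y < M
    contained : Contains q̂ q
    avoided   : Avoids π q

prepended⇒witness : {q : Permutation′ (suc n)} → Prepended q → Witness q
prepended⇒witness {q = q} P = witness π ρ (inj₂ (almost⇒ π-almost)) π-free avoided π↦ρ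
  (contains-trans ρ q̂ q ρ-contains contained)
  where open Prepended P

prepended⇒witness-ʳᶜ : {q : Permutation′ (suc n)} → suc (toℕ (first q)) < n → Prepended q → Witness (q ʳᶜ)
prepended⇒witness-ʳᶜ {q = q} lt P with Prepended.ʳᶜ-image P (Prepended.below-top P lt)
... | ρ′ , maps , co = witness (π ʳᶜ) (ρ′ ʳᶜ) (inj₂ (almost⇒ (almost-ʳᶜ π-almost))) (free-ʳᶜ π-free)
  (λ c → avoided (contains-trans π ((π ʳᶜ) ʳᶜ) q (contains-≅ (≅-sym (ʳᶜ-involutive π)))
    (contains-trans ((π ʳᶜ) ʳᶜ) ((q ʳᶜ) ʳᶜ) q (contains-ʳᶜ (π ʳᶜ) (q ʳᶜ) c) (contains-≅ (ʳᶜ-involutive q)))))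
  maps (contains-ʳᶜ ρ′ q (contains-trans ρ′ q̂ q co contained))
  where open Prepended P

first-inserted : (q : Permutation′ (suc n)) → Inserted zero (first q) (q ∖ first q) q
first-inserted q = subst (λ p → Inserted p (first q) (q ∖ first q) q) (inverseˡ q) (inserted-∖ q (first q))

value-suc : ∀ {V : Fin (suc n)} {π ρ} → Inserted zero V π ρ → ∀ i →
            toℕ (ρ ⟨$⟩ʳ suc i) ≡ up (toℕ V) (toℕ (π ⟨$⟩ʳ i))
value-suc {V = V} I i = trans (cong toℕ (rest I i)) (toℕ-punchIn V _)

-- Here `q̂` is q itself. As π has the same length as q, an occurrence of q in it would have to be
-- the identity embedding.
lastCut⇒prepended : ∀ {K} {r : Permutation′ n} {q : Permutation′ (suc n)} → Inserted zero
    (first q) r q → Free q → LastCut K r →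
               K ≤ toℕ (first q) → toℕ (first q) < n → Prepended q
lastCut⇒prepended {suc M} {K} {r} {q} I fr lc K≤f f<n =
  prepended r r-free lc y K≤y (λ lt → ℕ.≤-pred (subst (λ x → suc x < suc M) (sym toℕ-y) lt))
    (contains-≅ (inserted-unique (insertAt-inserted zero (inject₁ y) r) J ≅-refl)) avoids
  where
  r-free = free-contained {π = q} (contains-inserted I) fr
  y : Fin (suc M)
  y = fromℕ< f<n
  toℕ-y : toℕ y ≡ toℕ (first q)
  toℕ-y = Fin.toℕ-fromℕ< f<n
  K≤y : K ≤ toℕ y
  K≤y = subst (K ≤_) (sym toℕ-y) K≤f
  J : Inserted zero (inject₁ y) r q
  J = subst (λ v → Inserted zero v r q) (Fin.toℕ-injective (trans (sym toℕ-y) (sym (Fin.toℕ-inject₁ y)))) I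
  open Prepend r r-free lc y K≤y using (π)
  π-inserted : Inserted zero (suc y) r π
  π-inserted = insertAt-inserted _ _ _
  -- The entry of value y of r is smaller than the first entry of π but larger than that of q.
  avoids : Avoids π q
  avoids (e , mono , iff) = ℕ.<⇒≱ (subst₂ (λ a b → π ⟨$⟩ʳ a Fin.< π ⟨$⟩ʳ b) (e-id zero) (e-id (suc i))
      (Equivalence.from (iff zero (suc i)) q<))
    (ℕ.≤-trans (ℕ.≤-reflexive π-value) (ℕ.≤-trans (ℕ.n≤1+n _) (ℕ.≤-reflexive (sym (cong toℕ (point π-inserted))))))
    where
    e-id : ∀ i → e i ≡ i
    e-id i = Fin.toℕ-injective (ℕ.≤-antisym (ℕ.+-cancelʳ-≤ _ _ _ (embedding-≤ e mono i)) (embedding-≥ e mono i))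
    i = r ⟨$⟩ˡ y
    q-value : toℕ (q ⟨$⟩ʳ suc i) ≡ suc (toℕ y)
    q-value = trans (value-suc J i) (trans (cong₂ up (Fin.toℕ-inject₁ y) (cong toℕ (inverseʳ r))) (up-hi ℕ.≤-refl))
    q< : q ⟨$⟩ʳ zero Fin.< q ⟨$⟩ʳ suc i
    q< = ℕ.≤-reflexive (trans (cong suc (sym toℕ-y)) (sym q-value))
    π-value : toℕ (π ⟨$⟩ʳ suc i) ≡ toℕ y
    π-value = trans (value-suc π-inserted i) (trans (cong (λ v → up (suc (toℕ y)) (toℕ v)) (inverseʳ r))
        (up-lo ℕ.≤-refl))

-- The summand 1 supplies the cut that r lacks: it is the only cut of 1 ⊕ r, and 1 ⊕ r avoids 1324
-- because r avoids 213. Deleting the added 1 from `q̂` lowers the first entry to that of q.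
indecomposable⇒prepended : ∀ {r : Permutation′ n} {q : Permutation′ (suc n)} → Inserted zero (first q) r q →
  Avoids r p213 → (∀ {k} → ¬ Cut k r) → 0 < toℕ (first q) → toℕ (first q) < n → Prepended q
indecomposable⇒prepended {suc zero} I _ _ 0<f f<n = contradiction (ℕ.<-≤-trans f<n 0<f) (ℕ.<-irrefl refl)
indecomposable⇒prepended {suc (suc n)} {r} {q} I av none 0<f f<n =
  prepended s s-free s-cut y 1≤y (λ lt → subst (_< suc (suc n)) (sym toℕ-y) lt)
    (contains-inserted {P = suc zero} {zero} (inserted-swap s-inserted q̂-inserted (above z≤n)
      (swap-below z≤n (trans (Fin.toℕ-inject₁ y) toℕ-y) refl) I))
    avoids
  where
  f = first q
  s : Permutation′ (suc (suc (suc n)))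
  s = insertAt zero zero r
  s-inserted : Inserted zero zero r s
  s-inserted = insertAt-inserted zero zero r
  s-free : Free s
  s-free = free λ {a} {b} {c} {d} → go a b c d
    where
    lower : ∀ {i j} → s ⟨$⟩ʳ suc i Fin.< s ⟨$⟩ʳ suc j → r ⟨$⟩ʳ i Fin.< r ⟨$⟩ʳ j
    lower lt = ℕ.≤-pred (subst₂ _<_ (value-suc s-inserted _) (value-suc s-inserted _) lt)
    go : ∀ a b c d → a Fin.< b → b Fin.< c → c Fin.< d →
         s ⟨$⟩ʳ a Fin.< s ⟨$⟩ʳ c → s ⟨$⟩ʳ c Fin.< s ⟨$⟩ʳ b → s ⟨$⟩ʳ b Fin.< s ⟨$⟩ʳ d → ⊥
    go a (suc b) (suc c) (suc d) _ (s<s bc) (s<s cd) _ vc vb = av (contains r p213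
      (λ { 0F → b ; 1F → c ; 2F → d })
      (λ { 0F → bc ; 1F → cd })
      (λ { 0F → lower vc ; 1F → lower vb }))
  s-cut : LastCut 1 s
  s-cut = lastCut (cut z<s (s<s z<s) (closed-inserted-below s-inserted z≤n z≤n λ i → (λ ()) , (λ ())))
    λ { {suc zero} _ → ℕ.≤-refl
      ; {suc (suc j)} (cut _ b c) → contradiction (cut z<s (ℕ.≤-pred b)
          (closed-inserted-below⁻¹ s-inserted z≤n z≤n c)) none }
  y : Fin (suc (suc (suc n)))
  y = fromℕ< (s<s f<n)
  toℕ-y : toℕ y ≡ suc (toℕ f)
  toℕ-y = Fin.toℕ-fromℕ< (s<s f<n)
  1≤y : 1 ≤ toℕ y
  1≤y = subst (1 ≤_) (sym toℕ-y) (s≤s z≤n)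
  open Prepend s s-free s-cut y 1≤y using (π; q̂)
  π-inserted : Inserted zero (suc y) s π
  π-inserted = insertAt-inserted _ _ _
  q̂-inserted : Inserted zero (inject₁ y) s q̂
  q̂-inserted = insertAt-inserted _ _ _

  -- An occurrence of q in π must use the first entry of π, which then has to play the role of the first entry of q,
  -- but has one more entry below it; the second entry of π can only play the role of the minimum of q.
  avoids : Avoids π q
  avoids (e , mono , iff) = second (ℕ.<-≤-connex (toℕ (e (suc zero))) 2)
    where
    -- π is longer than q by one, so an occurrence skips a single position.
    e-upper : ∀ i → toℕ (e i) ≤ suc (toℕ i)
    e-upper i = ℕ.+-cancelʳ-≤ (suc (suc (suc n))) _ _
      (ℕ.≤-trans (embedding-≤ e mono i) (ℕ.≤-reflexive (ℕ.+-suc (toℕ i) _)))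
    π₁≡0 : ∀ {a} → toℕ a ≡ 1 → toℕ (π ⟨$⟩ʳ a) ≡ 0
    π₁≡0 {suc zero} refl = trans (value-suc π-inserted zero) (cong (λ v → up (suc (toℕ y)) (toℕ v))
        (point s-inserted))
    minimum : ∀ {a} → toℕ (e a) ≡ 1 → toℕ (q ⟨$⟩ʳ a) ≡ 0
    minimum {a} eq with toℕ (q ⟨$⟩ʳ a) in qa
    ... | zero  = refl
    ... | suc v = contradiction (subst (toℕ (π ⟨$⟩ʳ e (q ⟨$⟩ˡ zero)) <_) (π₁≡0 eq)
      (Equivalence.from (iff (q ⟨$⟩ˡ zero) a) (subst₂ _<_ (cong toℕ (sym (inverseʳ q))) (sym qa) z<s))) λ ()
    second : toℕ (e (suc zero)) < 2 ⊎ 2 ≤ toℕ (e (suc zero)) → ⊥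
    -- If the second entry of q is sent to the second entry of π, it is the minimum of q. Then r
    -- begins with its minimum and has the cut 1.
    second (inj₁ lt) = none (cut z<s (s<s z<s) one)
      where
      r₀≡0 : toℕ (r ⟨$⟩ʳ zero) ≡ 0
      r₀≡0 = up≡0 0<f (trans (sym (value-suc I zero))
        (minimum (ℕ.≤-antisym (ℕ.≤-pred lt) (embedding-≥ e mono (suc zero)))))
        where
        up≡0 : ∀ {i j} → 0 < i → up i j ≡ 0 → j ≡ 0
        up≡0 {suc i} {zero} _ _ = refl
      one : E.Closed 1 r
      one zero    = (λ _ → subst (_< 1) (sym r₀≡0) z<s) , (λ _ → z<s)
      one (suc i) = (λ { (s≤s ()) }) , λ { (s≤s le) → contradiction
        (to-injective r {suc i} {zero} (Fin.toℕ-injective (trans (ℕ.n≤0⇒n≡0 le) (sym r₀≡0)))) λ () }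
    -- Now every i + 1 is sent to i + 2, and only the image of the first entry is open. If it is the
    -- first entry of π, the entry of value f in r gives a contradiction: it lies above the first
    -- entry of q but below that of π.
    second (inj₂ 2≤e₁) = firstEntry (toℕ (e zero)) refl
      where
      f̂ : Fin (suc (suc n))
      f̂ = fromℕ< f<n
      toℕ-f̂ : toℕ f̂ ≡ toℕ f
      toℕ-f̂ = Fin.toℕ-fromℕ< f<n
      i = r ⟨$⟩ˡ f̂
      e-i : toℕ (e (suc i)) ≡ suc (suc (toℕ i))
      e-i = ℕ.≤-antisym (e-upper (suc i)) (ℕ.≤-trans (ℕ.+-monoˡ-≤ (toℕ i) 2≤e₁)
        (embedding-gap (e ∘ suc) (λ i j lt → mono (suc i) (suc j) (s<s lt)) i))
      q-value : toℕ (q ⟨$⟩ʳ suc i) ≡ suc (toℕ f)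
      q-value = trans (value-suc I i) (trans (cong (up (toℕ f)) (trans (cong toℕ (inverseʳ r)) toℕ-f̂))
          (up-hi ℕ.≤-refl))
      q< : q ⟨$⟩ʳ zero Fin.< q ⟨$⟩ʳ suc i
      q< = ℕ.≤-reflexive (sym q-value)
      π-value : toℕ (π ⟨$⟩ʳ suc (suc i)) ≡ toℕ y
      π-value = trans (value-suc π-inserted (suc i)) (trans (cong (up (suc (toℕ y)))
        (trans (value-suc s-inserted i) (trans (cong suc (trans (cong toℕ (inverseʳ r)) toℕ-f̂))
            (sym toℕ-y)))) (up-lo ℕ.≤-refl))
      firstEntry : ∀ v → toℕ (e zero) ≡ v → ⊥
      firstEntry zero eq = ℕ.<⇒≱ (subst₂ (λ a b → π ⟨$⟩ʳ a Fin.< π ⟨$⟩ʳ b) {y = zero} {v = suc (suc i)}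
          (Fin.toℕ-injective eq) (Fin.toℕ-injective e-i) (Equivalence.from (iff zero (suc i)) q<))
        (ℕ.≤-trans (ℕ.≤-reflexive π-value) (ℕ.≤-trans (ℕ.n≤1+n _) (ℕ.≤-reflexive (sym (cong toℕ
            (point π-inserted))))))
      firstEntry (suc zero) eq = ℕ.<-irrefl (sym (minimum eq)) 0<f
      firstEntry (suc (suc v)) eq = contradiction (subst (_≤ 1) eq (e-upper zero)) λ { (s≤s ()) }

-- Conditions (b), (c) and (d)

module _ {r : Permutation′ n} {q : Permutation′ (suc n)} (I : Inserted zero (first q) r q) where
  cut-suc : Cut k r → toℕ (first q) ≤ k → Cut (suc k) q
  cut-suc (cut _ b c) f≤k = cut z<s (s<s b) (closed-inserted-below I z≤n f≤k c)

  -- The entry just before the cut K is fixed, so r is closed at K - 1 as well. The prepended entry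
  -- lies below K and turns K - 1 and K into the cuts K and K + 1 of q.
  fixed⇒twoCuts : ∀ {A K} → toℕ (first q) < K → A < K → Cut K r → E.Closed A r → Fixed A K r → TwoCuts q
  fixed⇒twoCuts {A} {suc K} f<K A<K cK cA fx = suc K , suc (suc K) , ℕ.n<1+n _ ,
    cut z<s (ℕ.<-trans (bound cK) (ℕ.n<1+n _)) (closed-inserted-below I z≤n (ℕ.≤-pred f<K)
      (fixed-closed cA fx (ℕ.≤-pred A<K) (ℕ.n≤1+n K))) ,
    cut-suc cK (ℕ.<⇒≤ f<K)

module _ {q : Permutation′ (suc n)} {r : Permutation′ n} (I : Inserted zero (first q) r q) (fr : Free q) where
  private
    r-free : Free r
    r-free = free-contained {π = q} (contains-inserted I) fr

  -- If the first entry of q lies below the last cut K of r, then K + 1 is a cut of q. By `more`, r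
  -- then has two cuts, and hence a fixed point just before K.
  moreComponents : toℕ (first q) < n → ∃[ k ] Cut k r → (∀ {k} → Cut k q → TwoCuts r) → TwoCuts q ⊎ Prepended q
  moreComponents f<n c more with lastCut? r
  ... | inj₂ none = contradiction (proj₂ c) none
  ... | inj₁ (K , lc) with ℕ.<-≤-connex (toℕ (first q)) K
  ...   | inj₂ K≤f = inj₂ (lastCut⇒prepended I fr lc K≤f f<n)
  ...   | inj₁ f<K with more (cut-suc I (isCut lc) (ℕ.<⇒≤ f<K))
  ...     | i , j , i<j , ci , cj = inj₁ (fixed⇒twoCuts I f<K (ℕ.<-≤-trans i<j (max lc cj)) (isCut lc) (closed ci)
    (free⇒fixed r-free ci (isCut lc)))

  -- Deleting the first entry shortens the first component by one and leaves a cut of r at that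
  -- entry. A later cut of r would give q a second cut.
  largestFirst : 0 < toℕ (first q) → Cut (suc (toℕ (first q))) q → TwoCuts q ⊎ Prepended q
  largestFirst 0<f c with lastCut? r | cut 0<f (ℕ.≤-pred (bound c))
      (closed-inserted-below⁻¹ I z≤n ℕ.≤-refl (closed c))
  ... | inj₂ none | c′ = contradiction c′ none
  ... | inj₁ (K , lc) | c′ with ℕ.<-≤-connex (toℕ (first q)) K
  ...   | inj₂ K≤f = inj₂ (lastCut⇒prepended I fr lc K≤f (ℕ.≤-pred (bound c)))
  ...   | inj₁ f<K = inj₁ (_ , _ , s<s f<K , c , cut-suc I (isCut lc) (ℕ.<⇒≤ f<K))

  -- An inversion before the last cut K of r would form a 213 with the entry just after the cut. So
  -- r is the identity before K, and if the first entry of q lies below K, the fixed points from 0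
  -- to K give two cuts of q.
  avoids213 : 0 < toℕ (first q) → toℕ (first q) < n → Avoids r p213 → TwoCuts q ⊎ Prepended q
  avoids213 0<f f<n av with lastCut? r
  ... | inj₂ none = inj₂ (indecomposable⇒prepended I av none 0<f f<n)
  ... | inj₁ (K , lc) with ℕ.<-≤-connex (toℕ (first q)) K
  ...   | inj₂ K≤f = inj₂ (lastCut⇒prepended I fr lc K≤f f<n)
  ...   | inj₁ f<K = inj₁ (fixed⇒twoCuts I f<K (pos (isCut lc)) (isCut lc) trivial
    (increasing⇒fixed r (ℕ.<⇒≤ (bound (isCut lc))) trivial (closed (isCut lc)) (λ _ → inc)))
    where
    trivial : E.Closed 0 r
    trivial i = (λ ()) , λ ()
    K̂ = fromℕ< (bound (isCut lc))
    toℕ-K̂ : toℕ K̂ ≡ K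
    toℕ-K̂ = Fin.toℕ-fromℕ< (bound (isCut lc))
    inc : ∀ {i j} → i Fin.< j → toℕ j < K → r ⟨$⟩ʳ i Fin.< r ⟨$⟩ʳ j
    inc {i} {j} i<j j<K with Fin.<-cmp (r ⟨$⟩ʳ i) (r ⟨$⟩ʳ j)
    ... | tri< l _ _  = l
    ... | tri≈ _ eq _ rewrite to-injective r eq = contradiction i<j (ℕ.<-irrefl refl)
    ... | tri> _ _ g  = ⊥-elim (av (contains r p213 (λ { 0F → i ; 1F → j ; 2F → K̂ })
      (λ { 0F → i<j ; 1F → subst (toℕ j <_) (sym toℕ-K̂) j<K })
      (λ { 0F → g ; 1F → ℕ.<-≤-trans (closed-< {π = r} (closed (isCut lc)) (ℕ.<-trans i<j j<K))
                           (closed-≥ {π = r} (closed (isCut lc)) (ℕ.≤-reflexive (sym toℕ-K̂))) })))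

  classify : first₁ q < suc n × comp r > comp q ⊎
             Conditions.C q ⊎
             ((1 < first₁ q × first₁ q < suc n) × Avoids r p213) →
             TwoCuts q ⊎ Prepended q
  -- As q has at least one component, r has at least two. If q has a cut, each count is one higher.
  classify (inj₁ (f<n , more)) = moreComponents (ℕ.≤-pred f<n)
    (comp≥2⇒cut {π = r} (ℕ.≤-<-trans (comp≥1 q) more))
    (λ c → comp≥3⇒twoCuts {π = r} (ℕ.≤-<-trans (cut⇒comp≥2 c) more))
  classify (inj₂ (inj₁ (1<f , two , largest))) =
    largestFirst (ℕ.≤-pred 1<f) (beginsWithLargest⇒cut {q = q} two largest)
  classify (inj₂ (inj₂ ((1<f , f<n) , av))) = avoids213 (ℕ.≤-pred 1<f) (ℕ.≤-pred f<n) av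

-- The four symmetries

twoCuts-flip : {π : Permutation′ n} → TwoCuts π → TwoCuts (flip π)
twoCuts-flip (j , k , j<k , cj , ck) = j , k , j<k , cut-flip cj , cut-flip ck

twoCuts-ʳᶜ : {π : Permutation′ n} → TwoCuts π → TwoCuts (π ʳᶜ)
twoCuts-ʳᶜ {n} (j , k , j<k , cj , ck) =
  n ∸ k , n ∸ j , ℕ.∸-monoʳ-< j<k (ℕ.<⇒≤ (bound ck)) , cut-ʳᶜ ck , cut-ʳᶜ cj

twoCuts-≅ : {π ρ : Permutation′ n} → π ≅ ρ → TwoCuts π → TwoCuts ρ
twoCuts-≅ h (j , k , j<k , cj , ck) = j , k , j<k , cut-≅ h cj , cut-≅ h ck

apply-free : ∀ s {p : Permutation′ n} → Free p → Free (apply s p)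
apply-free self   fr = fr
apply-free inv    fr = free-flip fr
apply-free rc     fr = free-ʳᶜ fr
apply-free rc-inv fr = free-flip (free-ʳᶜ fr)

-- Whichever symmetry is chosen, two cuts can thus be handled for p itself, so (a) needs no extra
-- bound.
apply-twoCuts⁻¹ : ∀ s {p : Permutation′ n} → TwoCuts (apply s p) → TwoCuts p
apply-twoCuts⁻¹ self   t = t
apply-twoCuts⁻¹ inv    t = twoCuts-flip t
apply-twoCuts⁻¹ rc     {p} t = twoCuts-≅ (ʳᶜ-involutive p) (twoCuts-ʳᶜ t)
apply-twoCuts⁻¹ rc-inv {p} t = twoCuts-≅ (ʳᶜ-involutive p) (twoCuts-ʳᶜ (twoCuts-flip t))

-- Inversion carries witnesses to witnesses because f commutes with it. The reverse-complement needs
-- the separate computation of `ʳᶜ-image`, and with it the extra bound.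
prepended⇒witness-apply : ∀ s {p : Permutation′ (suc n)} → Conditions.Extra (apply s p) s →
                         Prepended (apply s p) → Witness p
prepended⇒witness-apply self   _      P = prepended⇒witness P
prepended⇒witness-apply inv    _      P = witness-flip (prepended⇒witness P)
prepended⇒witness-apply rc     {p} lt P = witness-≅ (ʳᶜ-involutive p) (prepended⇒witness-ʳᶜ lt P)
prepended⇒witness-apply rc-inv {p} lt P = witness-≅ (ʳᶜ-involutive p) (witness-flip (prepended⇒witness-ʳᶜ lt P))

theorem6p8 : ∀ {n} (p : Permutation′ (suc n)) → Avoids p p1324 →
    (Σ[ s ∈ Symmetry ]
    (let open Conditions (apply s p) in A ⊎ (Extra s × (B ⊎ C ⊎ D)))) →
    Incompatible p
theorem6p8 p av (s , condition) = witness⇒incompatible (go condition)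
  where
  fr : Free p
  fr = avoids⇒free av
  open Conditions (apply s p)
  settle : Extra s → TwoCuts (apply s p) ⊎ Prepended (apply s p) → Witness p
  settle _     (inj₁ t) = twoCuts⇒witness fr (apply-twoCuts⁻¹ s t)
  settle extra (inj₂ P) = prepended⇒witness-apply s extra P
  go : A ⊎ (Extra s × (B ⊎ C ⊎ D)) → Witness p
  go (inj₁ a)           = twoCuts⇒witness fr (apply-twoCuts⁻¹ s (comp≥3⇒twoCuts {π = apply s p} a))
  go (inj₂ (extra , c)) = settle extra (classify (first-inserted (apply s p)) (apply-free s fr) c)
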